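{- Let $r \ge 2$, $k\ge1$ and $n\ge 2rk$ be integers and let $A\subseteq[n]$ with $|A| \le b(r)\cdot (k-1)$. Then $$\chi(\mathrm{KG}^r_A(n,k)) = \left\lceil \frac{n - \max\{r(k-1),|A|\}}{r-1}\right\rceil.$$
   Context: For an integer $r\ge2$ with prime factorization $r=2^{\alpha_0}p_1^{\alpha_1}\cdots p_t^{\alpha_t}$ ($p_i$ pairwise distinct odd primes, $\alpha_i\ge0$), $b(r)=2^{\alpha_0}(p_1-1)^{\alpha_1}\cdots(p_t-1)^{\alpha_t}$. For a hypergraph $H$, an $m$-coloring is a map from the vertices to $[m]$ such that no hyperedge is monochromatic; $\chi(H)$ is the least such $m$. $\mathrm{KG}^r(n,k)$ is the hypergraph on the $k$-subsets of $[n]$ whose hyperedges are collections of $r$ pairwise disjoint $k$-subsets. For $A\subseteq[n]$, $\mathrm{KG}^r_A(n,k)$ is the subhypergraph of $\mathrm{KG}^r(n,k)$ induced by the $k$-subsets $\sigma\subseteq[n]$ with $\sigma\not\subseteq A$. -}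

module Defs where

open import Data.Nat using (ℕ; zero; suc; _+_; _*_; _∸_; _≤_; _≤?_)
open import Data.Nat.DivMod using (_/_)
open import Data.Nat.Divisibility using (_∣?_)
open import Data.Fin using (Fin)
open import Data.Fin.Subset using (Subset; _∈_; _⊆_; ∣_∣)
open import Data.Product using (Σ; _×_)
open import Data.Empty using (⊥)
open import Relation.Nullary using (¬_; yes; no)
open import Relation.Binary.PropositionalEquality using (_≡_; _≢_)

-- The function b(r).
-- b is the completely multiplicative function with b(2) = 2 and
-- b(p) = p - 1 for odd primes p, i.e. for r = 2^α₀ p₁^α₁ ⋯ p_t^α_t,
-- b(r) = 2^α₀ (p₁-1)^α₁ ⋯ (p_t-1)^α_t.  It is computed by repeatedly
-- splitting off the smallest prime factor of r.

-- smallest divisor (≥ 2 + e) of r, returned as an offset e' with the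
-- divisor being 2 + e'; `fuel` bounds the search.
spfOff : (fuel e r : ℕ) → ℕ
spfOff zero      e r = r ∸ 2
spfOff (suc fuel) e r with suc (suc e) ∣? r
... | yes _ = e
... | no  _ = spfOff fuel (suc e) r

-- weight of the prime p = 2 + e : 2 if p = 2, p - 1 otherwise
primeWeight : ℕ → ℕ
primeWeight zero    = 2
primeWeight (suc e) = suc (suc e)   -- = (2 + suc e) - 1

bAux : (fuel r : ℕ) → ℕ
bAux zero       r = 1
bAux (suc fuel) r with r ≤? 1
... | yes _ = 1
... | no  _ = let e = spfOff r 0 r in
              primeWeight e * bAux fuel (r / suc (suc e))

b : ℕ → ℕ
b r = bAux r r

-- Ceiling division ⌈ a / d ⌉ (d = 0 gives 0; only used with d ≥ 1).
ceilDiv : ℕ → ℕ → ℕ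
ceilDiv a zero    = 0
ceilDiv a (suc d) = (a + d) / suc d

max : ℕ → ℕ → ℕ
max = Data.Nat._⊔_

Vertex : (n k : ℕ) → Subset n → Set
Vertex n k A = Σ (Subset n) λ σ → (∣ σ ∣ ≡ k) × ¬ (σ ⊆ A)

Disjoint : {n : ℕ} → Subset n → Subset n → Set
Disjoint p q = ∀ x → x ∈ p → x ∈ q → ⊥

IsHyperedge : {n k : ℕ} {A : Subset n} (r : ℕ) → (Fin r → Vertex n k A) → Set
IsHyperedge r e = ∀ i j → i ≢ j → Disjoint (Data.Product.proj₁ (e i)) (Data.Product.proj₁ (e j))

IsColoring : (r n k : ℕ) (A : Subset n) (m : ℕ) → (Vertex n k A → Fin m) → Set
IsColoring r n k A m c =
  ∀ (e : Fin r → Vertex n k A) → IsHyperedge r e →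
  ¬ (Σ (Fin m) λ col → ∀ i → c (e i) ≡ col)

ChromaticNumberIs : (r n k : ℕ) (A : Subset n) (N : ℕ) → Set
ChromaticNumberIs r n k A N =
  (Σ (Vertex n k A → Fin N) λ c → IsColoring r n k A N c) ×
  (∀ (m : ℕ) (c : Vertex n k A → Fin m) → IsColoring r n k A m c → N ≤ m)

{-# OPTIONS --safe #-}

-- Since b(r) ≤ r, the maximum is r (k − 1), and the colouring by least
-- elements gives the upper bound.
--
-- For the lower bound, show more generally that if |A| ≤ r L and
-- r (k − 1) + (r − 1) m < n, then every m-colouring of the k-sets σ with
-- |σ ∩ A| ≤ L has r disjoint sets of one colour. If this holds for r₁ and
-- r₂ it holds for r₁ r₂: colour each set S of size r₁ (k − 1) + (r₁ − 1) m + 1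
-- with |S ∩ A| ≤ r₁ L by the colour of r₁ disjoint sets inside it. For a
-- prime p, let ℤ/p act on the partial functions X from [n] to ℤ/p. List [n]
-- with A first, cut it into blocks of p, and let h(X) be the sum over the
-- blocks of the number of values of X on the block. If h(X) > p (k − 1), some
-- value i is taken on k blocks, so X⁻¹(i) contains an admissible k-set; label
-- X by p (k − 1) plus the number of pairs (i, γ) such that X⁻¹(i) contains an
-- admissible set of colour γ. Otherwise label X by h(X). Without p disjoint
-- sets of one colour this label is at most p (k − 1) + (p − 1) m < n. Taking
-- the mean in ℤ/p of the first nonempty set of values used turns the label
-- into an equivariant monotone map to the join of fewer than n copies of ℤ/p,
-- which contradicts Dold's theorem.
--
-- Dold's theorem is proved with cochains modulo p: pull back along the signs
-- the normalised cocycles u of the periodic resolution of ℤ/p and evaluate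
-- them at explicit chains of the subdivided join of n copies of ℤ/p. The
-- value is 1, so some maximal chain has no two adjacent equal signs.

module Submission where

open import Defs
open import Data.Bool using (Bool; true; false)
open import Data.Empty using (⊥; ⊥-elim)
open import Data.Fin as Fin using (Fin; zero; suc; toℕ; inject₁; fromℕ; fromℕ<; remQuot; combine)
open import Data.Fin.Properties using (any?; all?; combine-remQuot; fromℕ≢inject₁; fromℕ<-injective; inject₁-injective; injective⇒≤; suc-injective; toℕ-fromℕ; toℕ-fromℕ<; toℕ-inject₁; toℕ-injective; toℕ<n; _≟_)
open import Data.Fin.Subset using (Subset; inside; outside; _∈_; _⊆_; _∩_; ∣_∣)
open import Data.Fin.Subset.Properties as Subsetₚ using (_⊆?_; _∈?_; anySubset?; p⊆q⇒∣p∣≤∣q∣; x∈p∩q⁺; x∈p∩q⁻; ⊆-trans)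
open import Data.Integer as ℤ using (ℤ; +_; -[1+_]; 0ℤ; 1ℤ)
open import Data.Integer.DivMod using (_/ℕ_; n%ℕd<d; a≡a%ℕn+[a/ℕn]*n)
import Data.Integer.Properties as ℤₚ
open import Data.Integer.Tactic.RingSolver using (solve-∀)
open import Data.List using (List; []; _∷_; map; length)
open import Data.List.Properties using (map-∘; map-cong; map-id; length-map)
open import Data.List.Relation.Unary.All as All using (All; []; _∷_)
open import Data.Maybe as Maybe using (Maybe; just; nothing)
import Data.Maybe.Properties as Maybeₚ
open import Data.Nat as ℕ using (ℕ; zero; suc; _≤_; _<_; _≤?_; _<?_; _∸_; z≤n; s≤s)
open import Data.Nat.Coprimality using (prime⇒coprime)
open import Data.Nat.DivMod using (_/_; _%_; m%n<n; m≡m%n+[m/n]*n; m/n*n≤m; m≥n⇒m/n>0; m<n*o⇒m/o<n)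
open import Data.Nat.Divisibility using (_∣?_; ∣⇒≤; divides)
open import Data.Nat.GCD using (GCD; module Bézout)
open import Data.Nat.Induction using (<-rec)
open import Data.Nat.Primality using (Prime; prime?; prime⇒nonTrivial; composite; ¬prime⇒composite)
import Data.Nat.Properties as ℕₚ
import Data.Nat.Tactic.RingSolver as ℕ-RingSolver
open import Data.Product using (Σ; ∃; _×_; _,_; proj₁; proj₂)
open import Data.Sum using (inj₁; inj₂)
open import Data.Unit using (⊤; tt)
open import Data.Vec as Vec using (Vec; []; _∷_; lookup; here; there)
import Data.Vec.Properties as Vecₚ
open import Function using (_∘_; id)
open import Function.Definitions using (Injective)
open import Level using (0ℓ)
open import Relation.Binary using (Setoid)
open import Relation.Binary.PropositionalEquality using (_≡_; _≢_; _≗_; refl; sym; trans; cong; cong₂; subst; module ≡-Reasoning)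
import Relation.Binary.Reasoning.Setoid as SetoidReasoning
open import Relation.Nullary using (¬_; Dec; yes; no; does)
open import Relation.Nullary.Decidable using (dec-true; _×-dec_)
open import Relation.Unary using (Decidable)

open import Algebra.Properties.CommutativeMonoid.Sum ℕₚ.+-0-commutativeMonoid using (sum; sum-cong-≗; ∑-comm; sum-init-last)
open Bézout.Identity using (+-; -+)
open Bézout.Lemma using (result)

-- Cochains and Dold's theorem

module Topology where

  open import Data.Integer using (_+_; _*_; _-_; -_)

  Cochain : Set → Set
  Cochain A = List A → ℤ

  -- The augmented simplicial coboundary: the empty list is the unique
  -- (−1)-simplex.
  δ : {A : Set} → Cochain A → Cochain A
  δ c []       = 0ℤ
  δ c (x ∷ xs) = c xs - δ (c ∘ (x ∷_)) xs

  iter : {A : Set} → ℕ → (A → A) → A → A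
  iter zero    f x = x
  iter (suc n) f x = iter n f (f x)

  ∑< : ℕ → (ℕ → ℤ) → ℤ
  ∑< zero    f = 0ℤ
  ∑< (suc n) f = f 0 + ∑< n (f ∘ suc)

  private
    variable
      A B : Set

  iter-comm : ∀ n (f : A → A) x → f (iter n f x) ≡ iter n f (f x)
  iter-comm zero    f x = refl
  iter-comm (suc n) f x = iter-comm n f (f x)

  iter-+ : ∀ m n (f : A → A) x → iter (m ℕ.+ n) f x ≡ iter n f (iter m f x)
  iter-+ zero    n f x = refl
  iter-+ (suc m) n f x = iter-+ m n f (f x)

  iter-map : ∀ n (f : A → A) xs → iter n (map f) xs ≡ map (iter n f) xs
  iter-map zero    f xs = sym (map-id xs)
  iter-map (suc n) f xs = trans (iter-map n f (map f xs)) (sym (map-∘ xs))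

  ∑<-cong : ∀ n {f g : ℕ → ℤ} → (∀ i → f i ≡ g i) → ∑< n f ≡ ∑< n g
  ∑<-cong zero    h = refl
  ∑<-cong (suc n) h = cong₂ _+_ (h 0) (∑<-cong n (h ∘ suc))

  ∑<-sub : ∀ n (f g : ℕ → ℤ) → ∑< n (λ i → f i - g i) ≡ ∑< n f - ∑< n g
  ∑<-sub zero    f g = refl
  ∑<-sub (suc n) f g rewrite ∑<-sub n (f ∘ suc) (g ∘ suc) =
    lemma (f 0) (g 0) (∑< n (f ∘ suc)) (∑< n (g ∘ suc))
    where
    lemma : ∀ a b c d → a - b + (c - d) ≡ a + c - (b + d)
    lemma = solve-∀

  ∑<-telescope : ∀ n (f : ℕ → ℤ) → ∑< n (λ i → f (suc i) - f i) ≡ f n - f 0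
  ∑<-telescope zero    f = sym (ℤₚ.+-inverseʳ (f 0))
  ∑<-telescope (suc n) f rewrite ∑<-telescope n (f ∘ suc) = lemma (f 1) (f 0) (f (suc n))
    where
    lemma : ∀ a b c → a - b + (c - a) ≡ c - b
    lemma = solve-∀

  δ-cong : {c c′ : Cochain A} → (∀ xs → c xs ≡ c′ xs) → ∀ xs → δ c xs ≡ δ c′ xs
  δ-cong h []       = refl
  δ-cong h (x ∷ xs) = cong₂ _-_ (h xs) (δ-cong (h ∘ (x ∷_)) xs)

  δ-0 : (xs : List A) → δ (λ _ → 0ℤ) xs ≡ 0ℤ
  δ-0 []       = refl
  δ-0 (x ∷ xs) rewrite δ-0 xs = refl

  δ-+ : (a b : Cochain A) → ∀ xs → δ (λ ys → a ys + b ys) xs ≡ δ a xs + δ b xs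
  δ-+ a b []       = refl
  δ-+ a b (x ∷ xs) rewrite δ-+ (a ∘ (x ∷_)) (b ∘ (x ∷_)) xs =
    lemma (a xs) (b xs) (δ (a ∘ (x ∷_)) xs) (δ (b ∘ (x ∷_)) xs)
    where
    lemma : ∀ a b c d → a + b - (c + d) ≡ a - c + (b - d)
    lemma = solve-∀

  δ-sub : (a b : Cochain A) → ∀ xs → δ (λ ys → a ys - b ys) xs ≡ δ a xs - δ b xs
  δ-sub a b []       = refl
  δ-sub a b (x ∷ xs) rewrite δ-sub (a ∘ (x ∷_)) (b ∘ (x ∷_)) xs =
    lemma (a xs) (b xs) (δ (a ∘ (x ∷_)) xs) (δ (b ∘ (x ∷_)) xs)
    where
    lemma : ∀ a b c d → a - b - (c - d) ≡ a - c - (b - d)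
    lemma = solve-∀

  δ-∑ : ∀ n (c : ℕ → Cochain A) xs → δ (λ ys → ∑< n (λ i → c i ys)) xs ≡ ∑< n (λ i → δ (c i) xs)
  δ-∑ zero    c xs = δ-0 xs
  δ-∑ (suc n) c xs = trans (δ-+ (c 0) (λ ys → ∑< n (λ i → c (suc i) ys)) xs)
                           (cong (_+_ (δ (c 0) xs)) (δ-∑ n (c ∘ suc) xs))

  δ-map : (f : A → B) (c : Cochain B) → ∀ xs → δ (c ∘ map f) xs ≡ δ c (map f xs)
  δ-map f c []       = refl
  δ-map f c (x ∷ xs) = cong (_-_ (c (map f xs))) (δ-map f (c ∘ (f x ∷_)) xs)

  δδ : (c : Cochain A) → ∀ xs → δ (δ c) xs ≡ 0ℤ
  δδ c []       = refl
  δδ c (x ∷ xs) rewrite δ-sub c (δ (c ∘ (x ∷_))) xs | δδ (c ∘ (x ∷_)) xs = lemma (δ c xs)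
    where
    lemma : ∀ a → a - (a - 0ℤ) ≡ 0ℤ
    lemma = solve-∀

  -- Normalised cochains, which vanish here, see only chains whose consecutive signs all differ; on
  -- such chains the level must rise strictly.
  data Degenerate {A : Set} : List A → Set where
    here  : ∀ {x xs} → Degenerate (x ∷ x ∷ xs)
    there : ∀ {x xs} → Degenerate xs → Degenerate (x ∷ xs)

  Normalised : Cochain A → Set
  Normalised c = ∀ {xs} → Degenerate xs → c xs ≡ 0ℤ

  Degenerate-map : (f : A → B) {xs : List A} → Degenerate xs → Degenerate (map f xs)
  Degenerate-map f here      = here
  Degenerate-map f (there d) = there (Degenerate-map f d)

  Degenerate-iter : ∀ n (f : A → A) {xs : List A} → Degenerate xs → Degenerate (iter n (map f) xs)
  Degenerate-iter zero    f d = d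
  Degenerate-iter (suc n) f d = Degenerate-iter n f (Degenerate-map f d)

  -- The two faces that drop one of the equal entries coincide and have opposite signs; every other
  -- face is still degenerate.
  δ-normalised : {c : Cochain A} → Normalised c → Normalised (δ c)
  δ-normalised {c = c} nc {x ∷ x ∷ xs} here =
    trans (cong (λ z → c (x ∷ xs) - (c (x ∷ xs) - z)) (trans (δ-cong (λ ys → nc here) xs) (δ-0 xs)))
          (lemma (c (x ∷ xs)))
    where
    lemma : ∀ a → a - (a - 0ℤ) ≡ 0ℤ
    lemma = solve-∀
  δ-normalised nc (there {x} d) = cong₂ _-_ (nc d) (δ-normalised (nc ∘ there {x = x}) d)

  -- Cochains of a product with an edge

  module Prism {A B : Set} (ι φ : A → B) where

    -- The simplicial homotopy between the maps induced by ι and φ.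
    H : Cochain B → Cochain A
    H c []       = 0ℤ
    H c (x ∷ xs) = c (ι x ∷ φ x ∷ map φ xs) - H (c ∘ (ι x ∷_)) xs

    -- The simplices of the prism at which `H` evaluates a cochain. They let congruences known only
    -- on chains pass through `H`.
    data _↗_ : List A → List B → Set where
      turn : ∀ {x xs} → (x ∷ xs) ↗ (ι x ∷ φ x ∷ map φ xs)
      keep : ∀ {x xs ys} → xs ↗ ys → (x ∷ xs) ↗ (ι x ∷ ys)

    H-sub : ∀ a b xs → H (λ ys → a ys - b ys) xs ≡ H a xs - H b xs
    H-sub a b []       = refl
    H-sub a b (x ∷ xs) rewrite H-sub (a ∘ (ι x ∷_)) (b ∘ (ι x ∷_)) xs =
      lemma (a (ι x ∷ φ x ∷ map φ xs)) (b (ι x ∷ φ x ∷ map φ xs)) (H (a ∘ (ι x ∷_)) xs) (H (b ∘ (ι x ∷_)) xs)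
      where
      lemma : ∀ a b c d → a - b - (c - d) ≡ a - c - (b - d)
      lemma = solve-∀

    -- Interior faces of the triangulated prism cancel in pairs, leaving its two ends and the prism
    -- over the boundary.
    H-homotopy : ∀ c xs → H (δ c) xs + δ (H c) xs ≡ c (map φ xs) - c (map ι xs)
    H-homotopy c []       = sym (ℤₚ.+-inverseʳ (c []))
    H-homotopy c (x ∷ xs)
      rewrite H-sub c (δ (c ∘ (ι x ∷_))) xs
            | δ-sub (λ ys → c (ι x ∷ φ x ∷ map φ ys)) (H (c ∘ (ι x ∷_))) xs
            | δ-map φ (λ ys → c (ι x ∷ φ x ∷ ys)) xs
      = trans (lemma (c (φ x ∷ map φ xs)) (c (ι x ∷ map φ xs)) (δ (λ ys → c (ι x ∷ φ x ∷ ys)) (map φ xs))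
                     (H c xs) (H (δ (c ∘ (ι x ∷_))) xs) (δ (H (c ∘ (ι x ∷_))) xs))
              (trans (cong (λ z → c (φ x ∷ map φ xs) - c (ι x ∷ map φ xs) + z) (H-homotopy (c ∘ (ι x ∷_)) xs))
                     (lemma₂ (c (φ x ∷ map φ xs)) (c (ι x ∷ map φ xs)) (c (ι x ∷ map ι xs))))
      where
      lemma : ∀ a b d h e f → a - (b - d) - (h - e) + (h - (d - f)) ≡ a - b + (e + f)
      lemma = solve-∀
      lemma₂ : ∀ a b c → a - b + (b - c) ≡ a - c
      lemma₂ = solve-∀

    -- Dual to sliding a simplex along the homotopy from ι to φ and then
    -- coning with apex b.
    D : B → Cochain B → Cochain A
    D b c xs = c (b ∷ map φ xs) - H c xs

    D-sub : ∀ b c c′ xs → D b (λ ys → c ys - c′ ys) xs ≡ D b c xs - D b c′ xs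
    D-sub b c c′ xs rewrite H-sub c c′ xs = lemma (c (b ∷ map φ xs)) (c′ (b ∷ map φ xs)) (H c xs) (H c′ xs)
      where
      lemma : ∀ a b c d → a - b - (c - d) ≡ a - c - (b - d)
      lemma = solve-∀

    -- The base of the cone is the `φ`-copy, and the homotopy exchanges it for the `ι`-copy: `ι` is
    -- null-homotopic in the cone.
    D-contracts : ∀ b c xs → D b (δ c) xs ≡ c (map ι xs) - δ (D b c) xs
    D-contracts b c xs rewrite δ-sub (λ ys → c (b ∷ map φ ys)) (H c) xs | δ-map φ (c ∘ (b ∷_)) xs =
      lemma (c (map φ xs)) (c (map ι xs)) (δ (c ∘ (b ∷_)) (map φ xs)) (H (δ c) xs) (δ (H c) xs) (H-homotopy c xs)
      where
      identity : ∀ a d h f → a - d - h ≡ a - (h + f) - (d - f)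
      identity = solve-∀
      identity₂ : ∀ a b d f → a - (a - b) - (d - f) ≡ b - (d - f)
      identity₂ = solve-∀
      lemma : ∀ a b d h f → h + f ≡ a - b → a - d - h ≡ b - (d - f)
      lemma a b d h f e = trans (identity a d h f)
        (trans (cong (λ z → a - z - (d - f)) e) (identity₂ a b d f))

  -- Congruence of integers

  module Congruence (p : ℕ) where

    infix 4 _≈_
    record _≈_ (a b : ℤ) : Set where
      constructor mod
      field
        quotient : ℤ
        equation : a ≡ b + quotient * + p

    ≡⇒≈ : ∀ {a b} → a ≡ b → a ≈ b
    ≡⇒≈ {a} refl = mod 0ℤ (lemma a (+ p))
      where
      lemma : ∀ a p → a ≡ a + 0ℤ * p
      lemma = solve-∀

    ≈-refl : ∀ {a} → a ≈ a
    ≈-refl = ≡⇒≈ refl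

    ≈-sym : ∀ {a b} → a ≈ b → b ≈ a
    ≈-sym {b = b} (mod k refl) = mod (- k) (lemma b k (+ p))
      where
      lemma : ∀ b k p → b ≡ b + k * p + - k * p
      lemma = solve-∀

    ≈-trans : ∀ {a b c} → a ≈ b → b ≈ c → a ≈ c
    ≈-trans {c = c} (mod k refl) (mod l refl) = mod (l + k) (lemma c k l (+ p))
      where
      lemma : ∀ c k l p → c + l * p + k * p ≡ c + (l + k) * p
      lemma = solve-∀

    +-≈ : ∀ {a b c d} → a ≈ b → c ≈ d → a + c ≈ b + d
    +-≈ {b = b} {d = d} (mod k refl) (mod l refl) = mod (k + l) (lemma b d k l (+ p))
      where
      lemma : ∀ b d k l p → b + k * p + (d + l * p) ≡ b + d + (k + l) * p
      lemma = solve-∀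

    *-≈ : ∀ a {b c} → b ≈ c → a * b ≈ a * c
    *-≈ a {c = c} (mod k refl) = mod (a * k) (lemma a c k (+ p))
      where
      lemma : ∀ a c k p → a * (c + k * p) ≡ a * c + a * k * p
      lemma = solve-∀

    neg-≈ : ∀ {a b} → a ≈ b → - a ≈ - b
    neg-≈ {b = b} (mod k refl) = mod (- k) (lemma b k (+ p))
      where
      lemma : ∀ b k p → - (b + k * p) ≡ - b + - k * p
      lemma = solve-∀

    sub-≈ : ∀ {a b c d} → a ≈ b → c ≈ d → a - c ≈ b - d
    sub-≈ h k = +-≈ h (neg-≈ k)

    p≈0 : + p ≈ 0ℤ
    p≈0 = mod 1ℤ (lemma (+ p))
      where
      lemma : ∀ p → p ≡ 0ℤ + 1ℤ * p
      lemma = solve-∀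

    ≈-setoid : Setoid 0ℓ 0ℓ
    ≈-setoid = record { _≈_ = _≈_ ; isEquivalence = record { refl = ≈-refl ; sym = ≈-sym ; trans = ≈-trans } }

    module ≈-Reasoning = SetoidReasoning ≈-setoid

    ∑<-≈ : ∀ n {f g : ℕ → ℤ} → (∀ i → f i ≈ g i) → ∑< n f ≈ ∑< n g
    ∑<-≈ zero    h = ≈-refl
    ∑<-≈ (suc n) h = +-≈ (h 0) (∑<-≈ n (h ∘ suc))

    δ-≈ : {A : Set} {c c′ : Cochain A} → (∀ xs → c xs ≈ c′ xs) → ∀ xs → δ c xs ≈ δ c′ xs
    δ-≈ h []       = ≈-refl
    δ-≈ h (x ∷ xs) = sub-≈ (h xs) (δ-≈ (h ∘ (x ∷_)) xs)

    1≉0 : 1 < p → ¬ (1ℤ ≈ 0ℤ)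
    1≉0 1<p (mod k e) = ℕₚ.<⇒≢ 1<p (sym (ℕₚ.m*n≡1⇒n≡1 ℤ.∣ k ∣ p
      (sym (trans (cong ℤ.∣_∣ (trans e (ℤₚ.+-identityˡ (k * + p)))) (ℤₚ.abs-* k (+ p))))))

  degenerate? : {n : ℕ} (xs : List (Fin n)) → Dec (Degenerate xs)
  degenerate? []           = no λ ()
  degenerate? (x ∷ [])     = no λ { (there ()) }
  degenerate? (x ∷ y ∷ xs) with x Fin.≟ y | degenerate? (y ∷ xs)
  ... | yes refl | _      = yes here
  ... | no _     | yes dg = yes (there dg)
  ... | no x≢y   | no nd  = no λ { here → x≢y refl ; (there dg) → nd dg }

  -- Cochains under a cyclic action

  module Cyclic (q : ℕ) where

    p : ℕ
    p = suc q

    open Congruence p public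

    module Action {A : Set} (g : A → A) where

      shift : List A → List A
      shift = map g

      -- The operators 1, g − 1, N, g − 1, N, … of the periodic resolution,
      -- where N = 1 + g + … + gᵖ⁻¹.
      T : ℕ → Cochain A → Cochain A
      T 0                   c xs = c xs
      T 1                   c xs = c (shift xs) - c xs
      T 2                   c xs = ∑< p (λ j → c (iter j shift xs))
      T (suc (suc (suc d))) c xs = T (suc d) c xs

      T-sub : ∀ d a b xs → T d (λ ys → a ys - b ys) xs ≡ T d a xs - T d b xs
      T-sub 0 a b xs = refl
      T-sub 1 a b xs = lemma (a (shift xs)) (b (shift xs)) (a xs) (b xs)
        where
        lemma : ∀ a b c d → a - b - (c - d) ≡ a - c - (b - d)
        lemma = solve-∀
      T-sub 2 a b xs = ∑<-sub p (λ j → a (iter j shift xs)) (λ j → b (iter j shift xs))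
      T-sub (suc (suc (suc d))) a b xs = T-sub (suc d) a b xs

      δ-iter : ∀ j c xs → δ (c ∘ iter j shift) xs ≡ δ c (iter j shift xs)
      δ-iter j c xs = begin
        δ (c ∘ iter j shift) xs   ≡⟨ δ-cong (cong c ∘ iter-map j g) xs ⟩
        δ (c ∘ map (iter j g)) xs ≡⟨ δ-map (iter j g) c xs ⟩
        δ c (map (iter j g) xs)   ≡⟨ cong (δ c) (iter-map j g xs) ⟨
        δ c (iter j shift xs)     ∎
        where open ≡-Reasoning

      T-δ : ∀ d c xs → T d (δ c) xs ≡ δ (T d c) xs
      T-δ 0 c xs = refl
      T-δ 1 c xs = sym (trans (δ-sub (c ∘ shift) c xs) (cong (_- δ c xs) (δ-map g c xs)))
      T-δ 2 c xs = sym (trans (δ-∑ p (λ j → c ∘ iter j shift) xs) (∑<-cong p (λ j → δ-iter j c xs)))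
      T-δ (suc (suc (suc d))) c xs = T-δ (suc d) c xs

      T-≈-on : (P : List A → Set) → (∀ {xs} → P xs → P (shift xs)) →
               ∀ d {c c′} → (∀ xs → P xs → c xs ≈ c′ xs) → ∀ xs → P xs → T d c xs ≈ T d c′ xs
      T-≈-on P Ps 0 h xs Pxs = h xs Pxs
      T-≈-on P Ps 1 h xs Pxs = sub-≈ (h _ (Ps Pxs)) (h xs Pxs)
      T-≈-on P Ps 2 h xs Pxs = ∑<-≈ p (λ j → h _ (go j Pxs))
        where
        go : ∀ j {ys} → P ys → P (iter j shift ys)
        go zero    h = h
        go (suc j) h = go j (Ps h)
      T-≈-on P Ps (suc (suc (suc d))) h xs Pxs = T-≈-on P Ps (suc d) h xs Pxs

      T-≈ : ∀ d {c c′} → (∀ xs → c xs ≈ c′ xs) → ∀ xs → T d c xs ≈ T d c′ xs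
      T-≈ d h xs = T-≈-on (λ _ → ⊤) _ d (λ ys _ → h ys) xs tt

      module Periodic (gᵖ : ∀ x → iter p g x ≡ x) where

        shiftᵖ : ∀ xs → iter p shift xs ≡ xs
        shiftᵖ xs = trans (iter-map p g xs) (trans (map-cong gᵖ xs) (map-id xs))

        ∑-telescopes : ∀ (c : Cochain A) xs → ∑< p (λ j → c (iter (suc j) shift xs) - c (iter j shift xs)) ≡ 0ℤ
        ∑-telescopes c xs = trans (∑<-telescope p (λ j → c (iter j shift xs)))
          (trans (cong (λ ys → c ys - c xs) (shiftᵖ xs)) (ℤₚ.+-inverseʳ (c xs)))

        -- In the group ring (g - 1) N = gᵖ - 1 = 0; both orders of composition telescope around the
        -- orbit.
        TT : ∀ d c xs → T (suc d) (T (suc (suc d)) c) xs ≡ 0ℤ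
        TT 0 c xs = trans (sym (∑<-sub p (λ j → c (iter (suc j) shift xs)) (λ j → c (iter j shift xs))))
                          (∑-telescopes c xs)
        TT 1 c xs = trans (∑<-cong p (λ j → cong (λ ys → c ys - c (iter j shift xs)) (iter-comm j shift xs)))
                          (∑-telescopes c xs)
        TT (suc (suc d)) c xs = TT d c xs

    module _ {A B : Set} (g : A → A) (h : B → B) (F : A → B) where

      private
        module Tᴬ = Action g
        module Tᴮ = Action h

      -- Equivariance is asked only at the entries of `xs`, since signs will be equivariant only at
      -- nonzero vectors.
      T-map : ∀ d c xs → All (λ x → ∀ j → F (iter j g x) ≡ iter j h (F x)) xs →
              Tᴬ.T d (c ∘ map F) xs ≡ Tᴮ.T d c (map F xs)
      T-map d c xs eqv = go d
        where
        eqvs : ∀ j {ys} → All (λ x → ∀ j → F (iter j g x) ≡ iter j h (F x)) ys →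
               map F (iter j (map g) ys) ≡ iter j (map h) (map F ys)
        eqvs j {ys} all = begin
          map F (iter j (map g) ys) ≡⟨ cong (map F) (iter-map j g ys) ⟩
          map F (map (iter j g) ys) ≡⟨ pointwise all ⟩
          map (iter j h) (map F ys) ≡⟨ iter-map j h (map F ys) ⟨
          iter j (map h) (map F ys) ∎
          where
          open ≡-Reasoning
          pointwise : ∀ {zs} → All (λ x → ∀ j → F (iter j g x) ≡ iter j h (F x)) zs →
                      map F (map (iter j g) zs) ≡ map (iter j h) (map F zs)
          pointwise []       = refl
          pointwise (e ∷ es) = cong₂ _∷_ (e j) (pointwise es)

        go : ∀ d → Tᴬ.T d (c ∘ map F) xs ≡ Tᴮ.T d c (map F xs)
        go 0 = refl
        go 1 = cong (λ z → c z - c (map F xs)) (eqvs 1 eqv)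
        go 2 = ∑<-cong p (λ j → cong c (eqvs j eqv))
        go (suc (suc (suc d))) = go (suc d)

    -- The cyclic group of signs

    -- The generator acts as subtraction of 1, so the head of a list counts the shifts that bring it
    -- to `zero`.
    rot : Fin p → Fin p
    rot zero    = fromℕ q
    rot (suc i) = inject₁ i

    rot-toℕ : ∀ s → + toℕ (rot s) + 1ℤ ≈ + toℕ s
    rot-toℕ zero    rewrite toℕ-fromℕ q =
      mod 1ℤ (trans (ℤₚ.+-comm (+ q) 1ℤ) (lemma (+ p)))
      where
      lemma : ∀ p → p ≡ 0ℤ + 1ℤ * p
      lemma = solve-∀
    rot-toℕ (suc i) rewrite toℕ-inject₁ i = ≡⇒≈ (ℤₚ.+-comm (+ toℕ i) 1ℤ)

    rot-injective : ∀ {s t} → rot s ≡ rot t → s ≡ t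
    rot-injective {zero}  {zero}  e = refl
    rot-injective {zero}  {suc t} e = ⊥-elim (fromℕ≢inject₁ e)
    rot-injective {suc s} {zero}  e = ⊥-elim (fromℕ≢inject₁ (sym e))
    rot-injective {suc s} {suc t} e = cong suc (inject₁-injective e)

    iter-rot-toℕ : ∀ m s → toℕ s ≡ m → iter m rot s ≡ zero
    iter-rot-toℕ zero    zero    e = refl
    iter-rot-toℕ (suc m) (suc i) e = iter-rot-toℕ m (inject₁ i) (trans (toℕ-inject₁ i) (ℕₚ.suc-injective e))

    rotᵖ : ∀ s → iter p rot s ≡ s
    rotᵖ s = iter-injective (toℕ s) (begin
      iter (toℕ s) rot (iter p rot s)  ≡⟨ iter-+ p (toℕ s) rot s ⟨
      iter (p ℕ.+ toℕ s) rot s  ≡⟨ cong (λ m → iter m rot s) (ℕₚ.+-comm p (toℕ s)) ⟩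
      iter (toℕ s ℕ.+ p) rot s  ≡⟨ iter-+ (toℕ s) p rot s ⟩
      iter p rot (iter (toℕ s) rot s)  ≡⟨ cong (iter p rot) (iter-rot-toℕ (toℕ s) s refl) ⟩
      iter p rot zero                  ≡⟨ iter-rot-toℕ q (fromℕ q) (toℕ-fromℕ q) ⟩
      zero                             ≡⟨ iter-rot-toℕ (toℕ s) s refl ⟨
      iter (toℕ s) rot s               ∎)
      where
      open ≡-Reasoning
      iter-injective : ∀ m {s t} → iter m rot s ≡ iter m rot t → s ≡ t
      iter-injective zero    e = e
      iter-injective (suc m) e = rot-injective (iter-injective m e)

    open Action rot using () renaming (T to Tˢ; shift to shiftˢ; T-δ to Tˢ-δ)

    -- lift d u solves T d ℓ = u, provided that T (suc d) u vanishes.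
    lift : ℕ → Cochain (Fin p) → Cochain (Fin p)
    lift 0 u ss             = u ss
    lift 1 u []             = 0ℤ
    lift 1 u (s ∷ ss)       = - ∑< (toℕ s) (λ i → u (iter i shiftˢ (s ∷ ss)))
    lift 2 u []             = 0ℤ
    lift 2 u (zero ∷ ss)    = u (zero ∷ ss)
    lift 2 u (suc _ ∷ ss)   = 0ℤ
    lift (suc (suc (suc d))) u ss = lift (suc d) u ss

    lift-normalised : ∀ d {u} → Normalised u → Normalised (lift d u)
    lift-normalised 0 nu dg = nu dg
    lift-normalised 1 nu {s ∷ ss} dg = cong -_ (vanish (toℕ s) (λ i → nu (Degenerate-iter i rot dg)))
      where
      vanish : ∀ m {f : ℕ → ℤ} → (∀ i → f i ≡ 0ℤ) → ∑< m f ≡ 0ℤ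
      vanish zero    h = refl
      vanish (suc m) h = cong₂ _+_ (h 0) (vanish m (h ∘ suc))
    lift-normalised 2 nu {zero ∷ ss}  dg = nu dg
    lift-normalised 2 nu {suc _ ∷ ss} dg = refl
    lift-normalised (suc (suc (suc d))) nu dg = lift-normalised (suc d) nu dg

    -- Partial orbit sums of consecutive shifts differ by one value of `u`. At head `zero` the shift
    -- jumps to head `q`, and the difference is `u` minus a full orbit sum, which is 0 modulo p by
    -- hypothesis.
    lift-solves-odd : ∀ u → (∀ ss → Tˢ 2 u ss ≈ 0ℤ) → u [] ≡ 0ℤ → ∀ ss → Tˢ 1 (lift 1 u) ss ≈ u ss
    lift-solves-odd u N u[] []       = ≡⇒≈ (sym u[])
    lift-solves-odd u N u[] (zero ∷ ss) rewrite toℕ-fromℕ q =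
      ≈-trans (≡⇒≈ (identity (u (zero ∷ ss)) rest)) (≈-trans (sub-≈ (≈-refl {u (zero ∷ ss)}) (N (zero ∷ ss))) (≡⇒≈ (ℤₚ.+-identityʳ _)))
      where
      rest = ∑< q (λ i → u (iter (suc i) shiftˢ (zero ∷ ss)))
      identity : ∀ a r → - r - (- 0ℤ) ≡ a - (a + r)
      identity = solve-∀
    lift-solves-odd u N u[] (suc i ∷ ss) rewrite toℕ-inject₁ i =
      ≡⇒≈ (identity (u (suc i ∷ ss)) (∑< (toℕ i) (λ j → u (iter (suc j) shiftˢ (suc i ∷ ss)))))
      where
      identity : ∀ a r → - r - (- (a + r)) ≡ a
      identity = solve-∀

    lift-solves-even : ∀ u → (∀ ss → Tˢ 1 u ss ≈ 0ℤ) → u [] ≡ 0ℤ → ∀ ss → Tˢ 2 (lift 2 u) ss ≈ u ss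
    lift-solves-even u inv u[] []       = ≡⇒≈ (trans (constant p) (sym u[]))
      where
      constant : ∀ m → ∑< m (λ j → lift 2 u (iter j shiftˢ [])) ≡ 0ℤ
      constant zero = refl
      constant (suc m) = trans (ℤₚ.+-identityˡ _) (constant m)
    -- The orbit of s ∷ ss meets the lists with head zero exactly once.
    lift-solves-even u inv u[] (s ∷ ss) = once p s ss (toℕ<n s) ℕₚ.≤-refl
      where
      invariant : ∀ ts → u (shiftˢ ts) ≈ u ts
      invariant ts = ≈-trans (≡⇒≈ (lemma (u (shiftˢ ts)) (u ts))) (≈-trans (+-≈ (inv ts) ≈-refl) (≡⇒≈ (ℤₚ.+-identityˡ (u ts))))
        where
        lemma : ∀ a b → a ≡ a - b + b
        lemma = solve-∀

      never : ∀ m t ts → m ≤ toℕ t → ∑< m (λ j → lift 2 u (iter j shiftˢ (t ∷ ts))) ≡ 0ℤ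
      never zero    t       ts h       = refl
      never (suc m) (suc t) ts (s≤s h) =
        trans (ℤₚ.+-identityˡ _) (never m (inject₁ t) (shiftˢ ts) (subst (m ≤_) (sym (toℕ-inject₁ t)) h))

      once : ∀ m t ts → toℕ t < m → m ≤ p → ∑< m (λ j → lift 2 u (iter j shiftˢ (t ∷ ts))) ≈ u (t ∷ ts)
      once (suc m) zero    ts h (s≤s m≤q) = ≡⇒≈ (trans
        (cong (_+_ (u (zero ∷ ts))) (never m (fromℕ q) (shiftˢ ts) (subst (m ≤_) (sym (toℕ-fromℕ q)) m≤q)))
        (ℤₚ.+-identityʳ _))
      once (suc m) (suc t) ts (s≤s h) m≤p = ≈-trans (≡⇒≈ (ℤₚ.+-identityˡ _)) (≈-trans
        (once m (inject₁ t) (shiftˢ ts) (subst (_< m) (sym (toℕ-inject₁ t)) h) (ℕₚ.≤-trans (ℕₚ.n≤1+n m) m≤p))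
        (invariant (suc t ∷ ts)))

    mutual

      -- The zigzag that computes the cohomology of ℤ/p: solve `T d (ℓ d) = u d` modulo p and take
      -- the coboundary. `u d` is supported on lists of length `d`.
      u : ℕ → Cochain (Fin p)
      u 0       []      = 1ℤ
      u 0       (_ ∷ _) = 0ℤ
      u (suc d) ss      = δ (ℓ d) ss

      ℓ : ℕ → Cochain (Fin p)
      ℓ d = lift d (u d)

    u-normalised : ∀ d → Normalised (u d)
    u-normalised 0       {_ ∷ _} dg = refl
    u-normalised (suc d) dg = δ-normalised (lift-normalised d (u-normalised d)) dg

    mutual

      T-ℓ : ∀ d ss → Tˢ d (ℓ d) ss ≈ u d ss
      T-ℓ 0       ss = ≈-refl
      T-ℓ (suc d) ss = lift-solves d (u (suc d)) refl (T-u d) ss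

      lift-solves : ∀ d c → c [] ≡ 0ℤ → (∀ ss → Tˢ (suc (suc d)) c ss ≈ 0ℤ) →
                    ∀ ss → Tˢ (suc d) (lift (suc d) c) ss ≈ c ss
      lift-solves 0             c c[] h = lift-solves-odd c h c[]
      lift-solves 1             c c[] h = lift-solves-even c h c[]
      lift-solves (suc (suc d)) c c[] h = lift-solves d c c[] h

      T-u : ∀ d ss → Tˢ (suc (suc d)) (u (suc d)) ss ≈ 0ℤ
      -- Here the sum over the group is p times a constant.
      T-u 0 ss = ≈-trans (≡⇒≈ (trans (constant p (λ j → trans (cong (u 1) (iter-map j rot ss)) (same (iter j rot))))
                                     (ℤₚ.*-comm (+ p) (u 1 ss))))
                         (≈-trans (*-≈ (u 1 ss) p≈0) (≡⇒≈ (ℤₚ.*-zeroʳ (u 1 ss))))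
        where
        constant : ∀ m {a} {f : ℕ → ℤ} → (∀ i → f i ≡ a) → ∑< m f ≡ + m * a
        constant zero        h = refl
        constant (suc m) {a} h = trans (cong₂ _+_ (h 0) (constant m (h ∘ suc))) (sym (ℤₚ.suc-* (+ m) a))
        same : ∀ f → u 1 (map f ss) ≡ u 1 ss
        same f = trans (sym (δ-map f (u 0) ss)) (δ-cong (λ { [] → refl ; (_ ∷ _) → refl }) ss)
      -- The index drops because `T` is periodic by definition.
      T-u (suc d) ss = begin
        Tˢ (suc d) (δ (ℓ (suc d))) ss ≡⟨ Tˢ-δ (suc d) (ℓ (suc d)) ss ⟩
        δ (Tˢ (suc d) (ℓ (suc d))) ss ≈⟨ δ-≈ (T-ℓ (suc d)) ss ⟩
        δ (δ (ℓ d)) ss                ≡⟨ δδ (ℓ d) ss ⟩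
        0ℤ                            ∎
        where open ≈-Reasoning

  -- The subdivided join of copies of ℤ/p

  module Dold (q : ℕ) where

    open Cyclic q

    -- A partial function from [d] to ℤ/p, that is, a possibly empty simplex of the join of d copies
    -- of ℤ/p. Chains of nonzero vectors are the simplices, possibly degenerate, of the barycentric
    -- subdivision.
    V : ℕ → Set
    V d = Vec (Maybe (Fin p)) d

    act : ∀ {d} → V d → V d
    act = Vec.map (Maybe.map rot)

    infix 4 _⊑_
    _⊑_ : ∀ {d} → V d → V d → Set
    X ⊑ Y = ∀ a i → lookup X a ≡ just i → lookup Y a ≡ just i

    NonZero : ∀ {d} → V d → Set
    NonZero X = ∃ λ a → ∃ λ i → lookup X a ≡ just i

    nonZero-⊑ : ∀ {d} (X Y : V d) → X ⊑ Y → NonZero X → NonZero Y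
    nonZero-⊑ X Y X⊑Y (a , i , e) = a , i , X⊑Y a i e

    lookup-act⁺ : ∀ {d} (X : V d) a {i} → lookup X a ≡ just i → lookup (act X) a ≡ just (rot i)
    lookup-act⁺ X a e = trans (Vecₚ.lookup-map a (Maybe.map rot) X) (cong (Maybe.map rot) e)

    lookup-act⁻ : ∀ {d} (X : V d) a {i} → lookup (act X) a ≡ just i → ∃ λ j → lookup X a ≡ just j × rot j ≡ i
    lookup-act⁻ X a e with lookup X a | trans (sym (Vecₚ.lookup-map a (Maybe.map rot) X)) e
    ... | just j | refl = j , refl , refl

    act-nonZero : ∀ {d} (X : V d) → NonZero X → NonZero (act X)
    act-nonZero X (a , i , e) = a , rot i , lookup-act⁺ X a e

    act-⊑ : ∀ {d} (X Y : V d) → X ⊑ Y → act X ⊑ act Y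
    act-⊑ X Y X⊑Y a i e with lookup-act⁻ X a e
    ... | j , e′ , refl = lookup-act⁺ Y a (X⊑Y a j e′)

    iter-act : ∀ {d} n (X : V d) → iter n act X ≡ Vec.map (Maybe.map (iter n rot)) X
    iter-act zero    X = sym (trans (Vecₚ.map-cong Maybeₚ.map-id X) (Vecₚ.map-id X))
    iter-act (suc n) X = trans (iter-act n (act X))
      (trans (sym (Vecₚ.map-∘ _ _ X)) (Vecₚ.map-cong (λ x → sym (Maybeₚ.map-∘ x)) X))

    actᵖ : ∀ {d} (X : V d) → iter p act X ≡ X
    actᵖ X = trans (iter-act p X) (trans (Vecₚ.map-cong (λ x → trans (Maybeₚ.map-cong rotᵖ x) (Maybeₚ.map-id x)) X) (Vecₚ.map-id X))

    Ascending : ∀ {d} → V d → List (V d) → Set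
    Ascending X []       = ⊤
    Ascending X (Y ∷ Ys) = X ⊑ Y × Ascending Y Ys

    Chain : ∀ {d} → List (V d) → Set
    Chain []       = ⊤
    Chain (X ∷ Xs) = NonZero X × Ascending X Xs

    map-ascending : ∀ {d e} (f : V d → V e) → (∀ X Y → X ⊑ Y → f X ⊑ f Y) →
                    ∀ X Xs → Ascending X Xs → Ascending (f X) (map f Xs)
    map-ascending f mono X []       _         = tt
    map-ascending f mono X (Y ∷ Ys) (h , asc) = mono X Y h , map-ascending f mono Y Ys asc

    act-chain : ∀ {d} {Xs : List (V d)} → Chain Xs → Chain (map act Xs)
    act-chain {Xs = []}     _          = tt
    act-chain {Xs = X ∷ Xs} (nz , asc) = act-nonZero X nz , map-ascending act act-⊑ X Xs asc

    chain-nonZero : ∀ {d} (Xs : List (V d)) → Chain Xs → All NonZero Xs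
    chain-nonZero []       _          = []
    chain-nonZero (X ∷ Xs) (nz , asc) = go X nz Xs asc
      where
      go : ∀ X → NonZero X → ∀ Xs → Ascending X Xs → All NonZero (X ∷ Xs)
      go X nz []       _         = nz ∷ []
      go X nz (Y ∷ Ys) (h , asc) = nz ∷ go Y (nonZero-⊑ X Y h nz) Ys asc

    -- The join gains one copy of ℤ/p, whose vertex `zero` is the `apex`. Since `ι X ⊑ φ X` and
    -- `apex ⊑ φ X`, prism and cone consist of chains.
    ι φ : ∀ {d} → V d → V (suc d)
    ι X = nothing ∷ X
    φ X = just zero ∷ X

    apex : ∀ {d} → V (suc d)
    apex = φ (Vec.replicate _ nothing)

    ι⊑ι : ∀ {d} (X Y : V d) → X ⊑ Y → ι X ⊑ ι Y
    ι⊑ι X Y h (suc a) i e = h a i e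

    ι⊑φ : ∀ {d} (X : V d) → ι X ⊑ φ X
    ι⊑φ X (suc a) i e = e

    φ⊑φ : ∀ {d} (X Y : V d) → X ⊑ Y → φ X ⊑ φ Y
    φ⊑φ X Y h zero    i e = e
    φ⊑φ X Y h (suc a) i e = h a i e

    apex⊑φ : ∀ {d} (X : V d) → apex ⊑ φ X
    apex⊑φ X zero    i e = e
    apex⊑φ X (suc a) i e with trans (sym (Vecₚ.lookup-replicate a nothing)) e
    ... | ()

    module _ {d : ℕ} where
      open Prism (ι {d}) φ public
      open Action (act {d}) public using (T; T-sub; T-δ; T-≈; T-≈-on)
      open Action.Periodic (act {d}) actᵖ public using (TT)

    ↗-ascending : ∀ {d} {X : V d} {Xs Ys} → (X ∷ Xs) ↗ Ys → Ascending X Xs →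
                  ∃ λ Zs → Ys ≡ ι X ∷ Zs × Ascending (ι X) Zs
    ↗-ascending {X = X} {Xs} turn asc =
      φ X ∷ map φ Xs , refl , ι⊑φ X , map-ascending φ φ⊑φ X Xs asc
    ↗-ascending {X = X} {Y ∷ Xs} (keep h) (X⊑Y , asc) with ↗-ascending h asc
    ... | Zs , refl , asc′ = ι Y ∷ Zs , refl , ι⊑ι X Y X⊑Y , asc′

    ↗-chain : ∀ {d} {Xs : List (V d)} {Ys} → Xs ↗ Ys → Chain Xs → Chain Ys
    ↗-chain {Xs = X ∷ Xs} h ((a , i , e) , asc) with ↗-ascending h asc
    ... | Zs , refl , asc′ = (suc a , i , e) , asc′

    ↗-length : ∀ {d} {Xs : List (V d)} {Ys} → Xs ↗ Ys → length Ys ≡ suc (length Xs)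
    ↗-length (turn {xs = Xs}) = cong (2 ℕ.+_) (length-map φ Xs)
    ↗-length (keep h)         = cong suc (↗-length h)

    cone-chain : ∀ {d} (Xs : List (V d)) → Chain Xs → Chain (apex ∷ map φ Xs)
    cone-chain []       _         = (zero , zero , refl) , tt
    cone-chain (X ∷ Xs) (_ , asc) =
      (zero , zero , refl) , apex⊑φ X , map-ascending φ φ⊑φ X Xs asc

    FullChain : ∀ {d} → List (V d) → Set
    FullChain {d} Xs = Chain Xs × length Xs ≡ d

    H-≈ : ∀ {d} {c c′ : Cochain (V (suc d))} Xs → (∀ {Ys} → Xs ↗ Ys → c Ys ≈ c′ Ys) → H c Xs ≈ H c′ Xs
    H-≈ []       h = ≈-refl
    H-≈ (X ∷ Xs) h = sub-≈ (h turn) (H-≈ Xs (h ∘ keep))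

    -- Prism and cone take chains to chains and raise the length by one.
    D-≈ : ∀ {d} {c c′ : Cochain (V (suc d))} → (∀ Ys → FullChain Ys → c Ys ≈ c′ Ys) →
          ∀ Xs → FullChain Xs → D apex c Xs ≈ D apex c′ Xs
    D-≈ h Xs (ch , len) = sub-≈
      (h _ (cone-chain Xs ch , cong suc (trans (length-map φ Xs) len)))
      (H-≈ Xs (λ s → h _ (↗-chain s ch , trans (↗-length s) (cong suc len))))

    act-fullChain : ∀ {d} {Xs : List (V d)} → FullChain Xs → FullChain (map act Xs)
    act-fullChain {Xs = Xs} (ch , len) = act-chain ch , trans (length-map act Xs) len

    -- Evaluation at a (d − 1)-chain z of the subdivided join of d copies of
    -- ℤ/p, whose boundary is the image under T of its predecessor.
    Z : ∀ d → Cochain (V d) → ℤ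
    Z zero    c = c []
    Z (suc d) c = Z d (T d (D apex c))

    Z-≈ : ∀ d {c c′ : Cochain (V d)} → (∀ Xs → FullChain Xs → c Xs ≈ c′ Xs) → Z d c ≈ Z d c′
    Z-≈ zero    h = h [] (tt , refl)
    Z-≈ (suc d) h = Z-≈ d (T-≈-on FullChain act-fullChain d (D-≈ h))

    Z-sub : ∀ d (a b : Cochain (V d)) → Z d (λ Xs → a Xs - b Xs) ≈ Z d a - Z d b
    Z-sub zero    a b = ≈-refl
    Z-sub (suc d) a b = ≈-trans
      (Z-≈ d (λ Xs _ → ≈-trans (T-≈ d (λ Ys → ≡⇒≈ (D-sub apex a b Ys)) Xs) (≡⇒≈ (T-sub d (D apex a) (D apex b) Xs))))
      (Z-sub d (T d (D apex a)) (T d (D apex b)))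

    Z-0 : ∀ d {c : Cochain (V d)} → (∀ Xs → FullChain Xs → c Xs ≈ 0ℤ) → Z d c ≈ 0ℤ
    Z-0 d {c} h = begin
      Z d c                      ≈⟨ Z-≈ d h ⟩
      Z d (λ _ → 0ℤ)             ≈⟨ Z-sub d (λ _ → 0ℤ) (λ _ → 0ℤ) ⟩
      Z d (λ _ → 0ℤ) - Z d (λ _ → 0ℤ) ≡⟨ ℤₚ.+-inverseʳ (Z d (λ _ → 0ℤ)) ⟩
      0ℤ                         ∎
      where open ≈-Reasoning

    act-ι : ∀ {d} j (X : V d) → ι (iter j act X) ≡ iter j act (ι X)
    act-ι zero    X = refl
    act-ι (suc j) X = act-ι j (act X)

    T-ι : ∀ {d} e (c : Cochain (V (suc d))) Xs → T e (c ∘ map ι) Xs ≡ T e c (map ι Xs)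
    T-ι e c Xs = T-map act act ι e c Xs (All.universal (λ X j → act-ι j X) Xs)

    -- `D-contracts` leaves the error term `Z d (T d (δ (D apex c)))`. As `T` commutes with `δ`,
    -- induction turns it into a composite of two consecutive operators `T`, which is 0.
    Z-δ : ∀ d (c : Cochain (V (suc d))) → Z (suc d) (δ c) ≈ Z d (T d (c ∘ map ι))
    Z-δ d c = begin
      Z d (T d (D apex (δ c)))
        ≈⟨ Z-≈ d (λ Xs _ → T-≈ d (λ Ys → ≡⇒≈ (D-contracts apex c Ys)) Xs) ⟩
      Z d (T d (λ Xs → c (map ι Xs) - δ (D apex c) Xs))
        ≈⟨ Z-≈ d (λ Xs _ → ≡⇒≈ (T-sub d (c ∘ map ι) (δ (D apex c)) Xs)) ⟩
      Z d (λ Xs → T d (c ∘ map ι) Xs - T d (δ (D apex c)) Xs)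
        ≈⟨ Z-sub d (T d (c ∘ map ι)) (T d (δ (D apex c))) ⟩
      Z d (T d (c ∘ map ι)) - Z d (T d (δ (D apex c)))
        ≈⟨ sub-≈ (≈-refl {Z d (T d (c ∘ map ι))}) (Z-Tδ d (D apex c)) ⟩
      Z d (T d (c ∘ map ι)) - 0ℤ
        ≡⟨ ℤₚ.+-identityʳ _ ⟩
      Z d (T d (c ∘ map ι)) ∎
      where
      open ≈-Reasoning
      Z-TT : ∀ d (e : Cochain (V d)) → Z d (T d (T (suc d) e)) ≈ 0ℤ
      -- The shift fixes the empty list, so g - 1 kills every cochain there.
      Z-TT zero    e = ≡⇒≈ (ℤₚ.+-inverseʳ (e []))
      Z-TT (suc d) e = Z-0 (suc d) (λ Xs _ → ≡⇒≈ (TT d e Xs))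

      Z-Tδ : ∀ d (e : Cochain (V d)) → Z d (T d (δ e)) ≈ 0ℤ
      Z-Tδ zero    e = ≈-refl
      Z-Tδ (suc d) e = begin
        Z (suc d) (T (suc d) (δ e))           ≈⟨ Z-≈ (suc d) (λ Xs _ → ≡⇒≈ (T-δ (suc d) e Xs)) ⟩
        Z (suc d) (δ (T (suc d) e))           ≈⟨ Z-δ d (T (suc d) e) ⟩
        Z d (T d (T (suc d) e ∘ map ι))       ≈⟨ Z-≈ d (λ Xs _ → T-≈ d (λ Ys → ≡⇒≈ (sym (T-ι (suc d) e Ys))) Xs) ⟩
        Z d (T d (T (suc d) (e ∘ map ι)))     ≈⟨ Z-TT d (e ∘ map ι) ⟩
        0ℤ                                    ∎

    Equivariant : ∀ {d} → (V d → Fin p) → Set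
    Equivariant F = ∀ X → NonZero X → F (act X) ≡ rot (F X)

    -- Induction along the zigzag: `u (suc d)` is the coboundary of `ℓ d`, so `Z-δ` moves the
    -- evaluation down to `T d (ℓ d)`, which is `u d`. In degree 0 the value is 1.
    Z-u : ∀ d (F : V d → Fin p) → Equivariant F → Z d (u d ∘ map F) ≈ 1ℤ
    Z-u zero    F eqv = ≈-refl
    Z-u (suc d) F eqv = begin
      Z (suc d) (δ (ℓ d) ∘ map F)               ≈⟨ Z-≈ (suc d) (λ Xs _ → ≡⇒≈ (sym (δ-map F (ℓ d) Xs))) ⟩
      Z (suc d) (δ (ℓ d ∘ map F))               ≈⟨ Z-δ d (ℓ d ∘ map F) ⟩
      Z d (T d (ℓ d ∘ map F ∘ map ι))           ≈⟨ Z-≈ d (λ Xs _ → T-≈ d (λ Ys → ≡⇒≈ (cong (ℓ d) (sym (map-∘ Ys)))) Xs) ⟩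
      Z d (T d (ℓ d ∘ map (F ∘ ι)))             ≈⟨ Z-≈ d pullback ⟩
      Z d (u d ∘ map (F ∘ ι))                   ≈⟨ Z-u d (F ∘ ι) eqvι ⟩
      1ℤ                                        ∎
      where
      open ≈-Reasoning
      eqvι : Equivariant (F ∘ ι)
      eqvι X (a , i , e) = eqv (ι X) (suc a , i , e)

      iterated : ∀ j X → NonZero X → F (ι (iter j act X)) ≡ iter j rot (F (ι X))
      iterated zero    X nz = refl
      iterated (suc j) X nz = trans (iterated j (act X) (act-nonZero X nz)) (cong (iter j rot) (eqvι X nz))

      pullback : ∀ Xs → FullChain Xs → T d (ℓ d ∘ map (F ∘ ι)) Xs ≈ u d (map (F ∘ ι) Xs)
      pullback Xs (ch , _) = ≈-trans
        (≡⇒≈ (T-map act rot (F ∘ ι) d (ℓ d) Xs (All.map (λ nz j → iterated j _ nz) (chain-nonZero Xs ch))))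
        (T-ℓ d (map (F ∘ ι) Xs))

    -- A monotone equivariant map to ℤ/p × {1, 2, …}, ordered by the second
    -- coordinate (the order complex is a join of copies of ℤ/p); it is
    -- undefined where the level is 0.
    record Labelling (n : ℕ) : Set where
      field
        level      : V n → ℕ
        sign       : V n → Fin p
        level-mono : ∀ X Y → X ⊑ Y → level X ≤ level Y
        level-act  : ∀ X → level (act X) ≡ level X
        sign-act   : ∀ X → 0 < level X → sign (act X) ≡ rot (sign X)
        sign-const : ∀ X Y → X ⊑ Y → 0 < level X → level X ≡ level Y → sign X ≡ sign Y

    module _ {n : ℕ} (Λ : Labelling n) (1<p : 1 < p) where
      open Labelling Λ

      -- With all levels below `n`, a chain of `n` nonzero vectors has two equal adjacent signs, so
      -- the normalised cochain `u n` vanishes on it, against `Z-u`.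
      dold : (∀ X → NonZero X → 0 < level X) → (∀ X → level X < n) → ⊥
      dold pos bound = 1≉0 1<p (≈-trans (≈-sym (Z-u n sign (λ X nz → sign-act X (pos X nz)))) (Z-0 n vanishes))
        where
        -- Where adjacent signs differ, `sign-const` excludes equal levels, so the level rises at
        -- every step.
        rising : ∀ X Xs → 0 < level X → Ascending X Xs → ¬ Degenerate (map sign (X ∷ Xs)) →
                 ∃ λ Y → level X ℕ.+ length Xs ≤ level Y
        rising X []       h _           nd = X , ℕₚ.≤-reflexive (ℕₚ.+-identityʳ _)
        rising X (Y ∷ Xs) h (X⊑Y , asc) nd with rising Y Xs (ℕₚ.≤-trans h (level-mono X Y X⊑Y)) asc (nd ∘ there)
        ... | W , le = W , (begin
          level X ℕ.+ suc (length Xs) ≡⟨ ℕₚ.+-suc (level X) (length Xs) ⟩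
          suc (level X) ℕ.+ length Xs ≤⟨ ℕₚ.+-monoˡ-≤ (length Xs) X<Y ⟩
          level Y ℕ.+ length Xs       ≤⟨ le ⟩
          level W                            ∎)
          where
          open ℕₚ.≤-Reasoning
          X<Y : level X < level Y
          X<Y = ℕₚ.≤∧≢⇒< (level-mono X Y X⊑Y) (λ e → nd (subst (λ s → Degenerate (sign X ∷ s ∷ map sign Xs)) (sign-const X Y X⊑Y h e) here))

        vanishes : ∀ Xs → FullChain Xs → u n (map sign Xs) ≈ 0ℤ
        -- An empty full chain means n = 0, and then no level can be below n.
        vanishes []       (_ , 0≡n) = ⊥-elim (ℕₚ.n≮0 (subst (level (Vec.replicate n nothing) <_) (sym 0≡n) (bound (Vec.replicate n nothing))))
        vanishes (X ∷ Xs) ((nz , asc) , len) with degenerate? (map sign (X ∷ Xs))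
        ... | yes dg = ≡⇒≈ (u-normalised n dg)
        ... | no nd with rising X Xs (pos X nz) asc nd
        ...   | W , le = ⊥-elim (ℕₚ.<⇒≱ (bound W)
                  (ℕₚ.≤-trans (ℕₚ.≤-reflexive (sym len)) (ℕₚ.≤-trans (ℕₚ.+-monoˡ-≤ (length Xs) (pos X nz)) le)))

open Topology
open import Data.Nat using (_+_; _*_)

-- Counting

𝟙 : Bool → ℕ
𝟙 true  = 1
𝟙 false = 0

count : ∀ {n} → (Fin n → Bool) → ℕ
count χ = sum (𝟙 ∘ χ)

sum-mono : ∀ {n} {f g : Fin n → ℕ} → (∀ i → f i ≤ g i) → sum f ≤ sum g
sum-mono {zero}  h = z≤n
sum-mono {suc n} h = ℕₚ.+-mono-≤ (h zero) (sum-mono (h ∘ suc))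

-- This will turn equality of levels into equality of the underlying sets of signs.
sum-mono-tight : ∀ {n} {f g : Fin n → ℕ} → (∀ i → f i ≤ g i) → sum f ≡ sum g → ∀ i → f i ≡ g i
sum-mono-tight {suc n} {f} {g} h e i = pointwise i
  where
  head : f zero ≡ g zero
  head = ℕₚ.≤-antisym (h zero) (ℕₚ.+-cancelʳ-≤ (sum (f ∘ suc)) (g zero) (f zero)
    (ℕₚ.≤-trans (ℕₚ.+-monoʳ-≤ (g zero) (sum-mono (h ∘ suc))) (ℕₚ.≤-reflexive (sym e))))
  tail : sum (f ∘ suc) ≡ sum (g ∘ suc)
  tail = ℕₚ.+-cancelˡ-≡ (g zero) _ _ (trans (cong (_+ sum (f ∘ suc)) (sym head)) e)
  pointwise : ∀ i → f i ≡ g i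
  pointwise zero    = head
  pointwise (suc i) = sum-mono-tight (h ∘ suc) tail i

sum-≤ : ∀ {n} {f : Fin n → ℕ} {k} → (∀ i → f i ≤ k) → sum f ≤ n * k
sum-≤ {zero}  h = z≤n
sum-≤ {suc n} h = ℕₚ.+-mono-≤ (h zero) (sum-≤ (h ∘ suc))

sum-positive : ∀ {n} (f : Fin n → ℕ) i → 0 < f i → 0 < sum f
sum-positive f zero    h = ℕₚ.≤-trans h (ℕₚ.m≤m+n _ _)
sum-positive f (suc i) h = ℕₚ.≤-trans (sum-positive (f ∘ suc) i h) (ℕₚ.m≤n+m _ _)

sum-pigeonhole : ∀ {n} (f : Fin n → ℕ) k → n * k < sum f → ∃ λ i → k < f i
sum-pigeonhole f k h with any? (λ i → k <? f i)
... | yes found = found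
... | no none   = ⊥-elim (ℕₚ.<⇒≱ h (sum-≤ (λ i → ℕₚ.≮⇒≥ (λ k<fi → none (i , k<fi)))))

𝟙≤1 : ∀ x → 𝟙 x ≤ 1
𝟙≤1 true  = ℕₚ.≤-refl
𝟙≤1 false = z≤n

𝟙-mono : ∀ {x y} → (x ≡ true → y ≡ true) → 𝟙 x ≤ 𝟙 y
𝟙-mono {true}  {y} h rewrite h refl = ℕₚ.≤-refl
𝟙-mono {false}     h = z≤n

𝟙-injective : ∀ {x y} → 𝟙 x ≡ 𝟙 y → x ≡ y
𝟙-injective {true}  {true}  e = refl
𝟙-injective {false} {false} e = refl

count≤n : ∀ {n} (χ : Fin n → Bool) → count χ ≤ n
count≤n {n} χ = ℕₚ.≤-trans (sum-≤ (𝟙≤1 ∘ χ)) (ℕₚ.≤-reflexive (ℕₚ.*-identityʳ n))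

count-positive : ∀ {n} (χ : Fin n → Bool) i → χ i ≡ true → 0 < count χ
count-positive χ i e = sum-positive (𝟙 ∘ χ) i (ℕₚ.≤-reflexive (cong 𝟙 (sym e)))

full⇒all : ∀ {n} (χ : Fin n → Bool) → n ≤ count χ → ∀ i → χ i ≡ true
full⇒all {n} χ h i = 𝟙-injective {χ i} {true} (sum-mono-tight (𝟙≤1 ∘ χ) (trans (ℕₚ.≤-antisym (count≤n χ) h) (sym (all n))) i)
  where
  all : ∀ m → sum {m} (λ _ → 1) ≡ m
  all zero    = refl
  all (suc m) = cong suc (all m)

enumerate : ∀ {n} (χ : Fin n → Bool) k → k ≤ count χ →
            Σ (Fin k → Fin n) λ f → Injective _≡_ _≡_ f × (∀ t → χ (f t) ≡ true)
enumerate         χ zero    h = (λ ()) , (λ { {()} }) , λ ()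
enumerate {zero}  χ (suc k) ()
enumerate {suc n} χ (suc k) h with χ zero in e
... | false with enumerate (χ ∘ suc) (suc k) h
...   | f , inj , mem = suc ∘ f , inj ∘ suc-injective , mem
enumerate {suc n} χ (suc k) (s≤s h) | true with enumerate (χ ∘ suc) k h
... | f , inj , mem = g , g-injective , g-mem
  where
  g : Fin (suc k) → Fin (suc n)
  g zero    = zero
  g (suc t) = suc (f t)
  g-injective : Injective _≡_ _≡_ g
  g-injective {zero}  {zero}  _ = refl
  g-injective {suc s} {suc t} e = cong suc (inj (suc-injective e))
  g-mem : ∀ t → χ (g t) ≡ true
  g-mem zero    = e
  g-mem (suc t) = mem t

rank : ∀ {n} → (Fin n → Bool) → Fin n → ℕ
rank χ zero    = 0
rank χ (suc i) = 𝟙 (χ zero) + rank (χ ∘ suc) i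

rank<count : ∀ {n} (χ : Fin n → Bool) i → χ i ≡ true → rank χ i < count χ
rank<count χ zero    e rewrite e = s≤s z≤n
rank<count χ (suc i) e = ℕₚ.+-monoʳ-< (𝟙 (χ zero)) (rank<count (χ ∘ suc) i e)

rank-injective : ∀ {n} (χ : Fin n → Bool) i j → χ i ≡ true → χ j ≡ true → rank χ i ≡ rank χ j → i ≡ j
rank-injective χ zero    zero    ei ej r = refl
rank-injective χ zero    (suc j) ei ej r rewrite ei with r
... | ()
rank-injective χ (suc i) zero    ei ej r rewrite ej with r
... | ()
rank-injective χ (suc i) (suc j) ei ej r =
  cong suc (rank-injective (χ ∘ suc) i j ei ej (ℕₚ.+-cancelˡ-≡ (𝟙 (χ zero)) _ _ r))

injective⇒≤count : ∀ {k n} (f : Fin k → Fin n) → Injective _≡_ _≡_ f →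
                   (χ : Fin n → Bool) → (∀ t → χ (f t) ≡ true) → k ≤ count χ
injective⇒≤count f inj χ mem = injective⇒≤ {f = λ t → fromℕ< (rank<count χ (f t) (mem t))}
  (λ e → inj (rank-injective χ _ _ (mem _) (mem _) (fromℕ<-injective _ _ _ _ e)))

∣∣≡count : ∀ {n} (σ : Subset n) → ∣ σ ∣ ≡ count (lookup σ)
∣∣≡count []            = refl
∣∣≡count (inside  ∷ σ) = cong suc (∣∣≡count σ)
∣∣≡count (outside ∷ σ) = ∣∣≡count σ

enumerate-∈ : ∀ {n k} (σ : Subset n) → ∣ σ ∣ ≡ k → Σ (Fin k → Fin n) λ f → Injective _≡_ _≡_ f × (∀ t → f t ∈ σ)
enumerate-∈ {k = k} σ refl with enumerate (lookup σ) k (ℕₚ.≤-reflexive (∣∣≡count σ))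
... | f , inj , mem = f , inj , λ t → Vecₚ.lookup⇒[]= (f t) σ (mem t)

subsetOfSize : ∀ {n} (χ : Fin n → Bool) k → k ≤ count χ →
               ∃ λ σ → ∣ σ ∣ ≡ k × (∀ a → a ∈ σ → χ a ≡ true)
subsetOfSize {n}     χ zero    h = Data.Fin.Subset.⊥ , Subsetₚ.∣⊥∣≡0 n , λ a a∈ → ⊥-elim (Subsetₚ.∉⊥ a∈)
subsetOfSize {suc n} χ (suc k) h with χ zero in e
... | false with subsetOfSize (χ ∘ suc) (suc k) h
...   | σ , size , mem = outside ∷ σ , size , λ { (suc a) (there a∈) → mem a a∈ }
subsetOfSize {suc n} χ (suc k) (s≤s h) | true with subsetOfSize (χ ∘ suc) k h
... | σ , size , mem = inside ∷ σ , cong suc size , λ { zero here → e ; (suc a) (there a∈) → mem a a∈ }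

∣∣≤-of-injection : ∀ {n} (σ : Subset n) (β : Fin n → ℕ) {l} → (∀ a → a ∈ σ → β a < l) →
                   (∀ a b → a ∈ σ → b ∈ σ → β a ≡ β b → a ≡ b) → ∣ σ ∣ ≤ l
∣∣≤-of-injection σ β β<l inj with enumerate-∈ σ refl
... | f , f-injective , f∈ = injective⇒≤ {f = λ t → fromℕ< (β<l (f t) (f∈ t))}
  (λ e → f-injective (inj _ _ (f∈ _) (f∈ _) (fromℕ<-injective _ _ _ _ e)))

does⇒ : {P : Set} (P? : Dec P) → does P? ≡ true → P
does⇒ (yes p) _ = p

-- Equivariant choice of signs

module Labellings (q : ℕ) (p-prime : Prime (suc q)) where

  open Cyclic q
  open Dold q

  1<p : 1 < p
  1<p = ℕ.nonTrivial⇒n>1 p {{prime⇒nonTrivial p-prime}}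

  toℕ-≈-injective : ∀ s t → + toℕ s ≈ + toℕ t → s ≡ t
  toℕ-≈-injective s t (mod k e) = toℕ-injective (go k e)
    where
    small : ∀ a b m → a < p → + a ≡ + b ℤ.+ + m ℤ.* + p → a ≡ b
    small a b zero    a<p e = trans (ℤₚ.+-injective e) (ℕₚ.+-identityʳ b)
    small a b (suc m) a<p e = ⊥-elim (ℕₚ.<⇒≱ a<p (ℕₚ.≤-trans (ℕₚ.m≤m+n p (m * p))
      (ℕₚ.≤-trans (ℕₚ.m≤n+m _ b) (ℕₚ.≤-reflexive (sym (ℤₚ.+-injective (trans e (cong (ℤ._+_ (+ b)) (sym (ℤₚ.pos-* (suc m) p))))))))))
    swap : ∀ b k p → b ≡ b ℤ.+ k ℤ.* p ℤ.+ ℤ.- k ℤ.* p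
    swap = solve-∀
    go : ∀ k → + toℕ s ≡ + toℕ t ℤ.+ k ℤ.* + p → toℕ s ≡ toℕ t
    go (+ m)    e = small (toℕ s) (toℕ t) m (toℕ<n s) e
    go -[1+ m ] e = sym (small (toℕ t) (toℕ s) (suc m) (toℕ<n t)
      (trans (swap (+ toℕ t) -[1+ m ] (+ p)) (cong (ℤ._+ + suc m ℤ.* + p) (sym e))))

  sum-rot : (f : Fin p → ℕ) → sum (f ∘ rot) ≡ sum f
  sum-rot f = trans (ℕₚ.+-comm (f (fromℕ q)) _) (sym (sum-init-last f))

  weight : (Fin p → Bool) → ℕ
  weight χ = sum (λ i → 𝟙 (χ i) * toℕ i)

  inverse : ℕ → ℤ
  inverse t with Bézout.lemma t p
  ... | result _ _ (+- x _ _) = + x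
  ... | result _ _ (-+ x _ _) = ℤ.- + x

  -- Since p is prime and 0 < t < p, the gcd in Bézout's identity is 1, so the coefficient of `t`
  -- inverts it modulo p.
  inverse-≈ : ∀ t → 0 < t → t < p → inverse t ℤ.* + t ≈ 1ℤ
  inverse-≈ t 0<t t<p with Bézout.lemma t p
  ... | result d g b with prime⇒coprime p-prime {{ℕ.>-nonZero 0<t}} t<p (proj₂ (GCD.commonDivisor g) , proj₁ (GCD.commonDivisor g))
  inverse-≈ t 0<t t<p | result .1 g (+- x y eq) | refl = mod (+ y)
    (trans (sym (ℤₚ.pos-* x t)) (trans (cong +_ (sym eq)) (trans (ℤₚ.pos-+ 1 (y * p)) (cong (ℤ._+_ 1ℤ) (ℤₚ.pos-* y p)))))
  inverse-≈ t 0<t t<p | result .1 g (-+ x y eq) | refl = mod (ℤ.- + y)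
    (trans (identity (+ x) (+ t)) (trans (cong (λ z → 1ℤ ℤ.- z) eqℤ) (identity₂ (+ y) (+ p))))
    where
    eqℤ : 1ℤ ℤ.+ + x ℤ.* + t ≡ + y ℤ.* + p
    eqℤ = trans (cong (ℤ._+_ 1ℤ) (sym (ℤₚ.pos-* x t))) (trans (cong +_ eq) (ℤₚ.pos-* y p))
    identity : ∀ x t → ℤ.- x ℤ.* t ≡ 1ℤ ℤ.- (1ℤ ℤ.+ x ℤ.* t)
    identity = solve-∀
    identity₂ : ∀ y p → 1ℤ ℤ.- y ℤ.* p ≡ 1ℤ ℤ.+ ℤ.- y ℤ.* p
    identity₂ = solve-∀

  -- The arithmetic mean in ℤ/p: a choice of an element of ℤ/p that is
  -- equivariant on the nonempty proper subsets, because p is prime.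
  abstract
    mean : (Fin p → Bool) → Fin p
    mean χ = fromℕ< (n%ℕd<d (inverse (count χ) ℤ.* + weight χ) p)

    mean-≈ : ∀ χ → + toℕ (mean χ) ≈ inverse (count χ) ℤ.* + weight χ
    mean-≈ χ = ≈-trans (≡⇒≈ (cong +_ (toℕ-fromℕ< (n%ℕd<d z p)))) (≈-sym (mod (z /ℕ p) (a≡a%ℕn+[a/ℕn]*n z p)))
      where
      z : ℤ
      z = inverse (count χ) ℤ.* + weight χ

  mean-cong : ∀ {χ χ′} → χ ≗ χ′ → mean χ ≡ mean χ′
  mean-cong {χ} {χ′} h = toℕ-≈-injective _ _ (≈-trans (mean-≈ χ) (≈-trans (≡⇒≈
    (cong₂ (λ a b → inverse a ℤ.* + b) (sum-cong-≗ (cong 𝟙 ∘ h)) (sum-cong-≗ (λ i → cong (λ z → 𝟙 z * toℕ i) (h i)))))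
    (≈-sym (mean-≈ χ′))))

  module _ {χ χ′ : Fin p → Bool} (eqv : ∀ i → χ′ (rot i) ≡ χ i) where

    count-rot : count χ′ ≡ count χ
    count-rot = trans (sym (sum-rot (𝟙 ∘ χ′))) (sum-cong-≗ (cong 𝟙 ∘ eqv))

    weight-rot : + weight χ′ ℤ.+ + count χ ≈ + weight χ
    weight-rot = ≈-trans (≡⇒≈ (cong (λ w → + w ℤ.+ + count χ)
        (trans (sym (sum-rot (λ i → 𝟙 (χ′ i) * toℕ i))) (sum-cong-≗ (λ i → cong (λ z → 𝟙 z * toℕ (rot i)) (eqv i))))))
      (go (𝟙 ∘ χ) (toℕ ∘ rot) toℕ rot-toℕ)
      where
      distrib : ∀ c f s t → c ℤ.* f ℤ.+ s ℤ.+ (c ℤ.+ t) ≡ c ℤ.* (f ℤ.+ 1ℤ) ℤ.+ (s ℤ.+ t)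
      distrib = solve-∀
      go : ∀ {m} (c f g : Fin m → ℕ) → (∀ i → + f i ℤ.+ 1ℤ ≈ + g i) →
           + sum (λ i → c i * f i) ℤ.+ + sum c ≈ + sum (λ i → c i * g i)
      go {zero}  c f g h = ≈-refl
      go {suc m} c f g h = begin
        + (c zero * f zero + sf) ℤ.+ + (c zero + sc)
          ≡⟨ cong₂ ℤ._+_ (trans (ℤₚ.pos-+ (c zero * f zero) sf) (cong (ℤ._+ + sf) (ℤₚ.pos-* (c zero) (f zero)))) (ℤₚ.pos-+ (c zero) sc) ⟩
        + c zero ℤ.* + f zero ℤ.+ + sf ℤ.+ (+ c zero ℤ.+ + sc)
          ≡⟨ distrib (+ c zero) (+ f zero) (+ sf) (+ sc) ⟩
        + c zero ℤ.* (+ f zero ℤ.+ 1ℤ) ℤ.+ (+ sf ℤ.+ + sc)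
          ≈⟨ +-≈ (*-≈ (+ c zero) (h zero)) (go (c ∘ suc) (f ∘ suc) (g ∘ suc) (h ∘ suc)) ⟩
        + c zero ℤ.* + g zero ℤ.+ + sg
          ≡⟨ cong (ℤ._+ + sg) (sym (ℤₚ.pos-* (c zero) (g zero))) ⟩
        + (c zero * g zero) ℤ.+ + sg
          ≡⟨ ℤₚ.pos-+ (c zero * g zero) sg ⟨
        + (c zero * g zero + sg) ∎
        where
        open ≈-Reasoning
        sf sc sg : ℕ
        sf = sum (λ i → c (suc i) * f (suc i))
        sc = sum (c ∘ suc)
        sg = sum (λ i → c (suc i) * g (suc i))

    -- `rot` lowers each element by 1, hence the weight by the size of the set. Dividing by the
    -- size, which is invertible modulo p, lowers the mean by 1.
    mean-rot : 0 < count χ → count χ < p → mean χ′ ≡ rot (mean χ)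
    mean-rot 0<c c<p = toℕ-≈-injective _ _ (begin
      + toℕ (mean χ′)                                       ≈⟨ mean-≈ χ′ ⟩
      inverse (count χ′) ℤ.* + weight χ′                    ≡⟨ cong (λ z → inverse z ℤ.* + weight χ′) count-rot ⟩
      inverse (count χ) ℤ.* + weight χ′                     ≡⟨ identity (inverse (count χ)) (+ weight χ′) (+ count χ) ⟩
      inverse (count χ) ℤ.* (+ weight χ′ ℤ.+ + count χ) ℤ.- inverse (count χ) ℤ.* + count χ
                                                            ≈⟨ sub-≈ (*-≈ (inverse (count χ)) weight-rot) (inverse-≈ (count χ) 0<c c<p) ⟩
      inverse (count χ) ℤ.* + weight χ ℤ.- 1ℤ               ≈⟨ sub-≈ (≈-sym (mean-≈ χ)) (≈-refl {1ℤ}) ⟩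
      + toℕ (mean χ) ℤ.- 1ℤ                                 ≈⟨ sub-≈ (≈-sym (rot-toℕ (mean χ))) (≈-refl {1ℤ}) ⟩
      + toℕ (rot (mean χ)) ℤ.+ 1ℤ ℤ.- 1ℤ                    ≡⟨ identity₂ (+ toℕ (rot (mean χ))) ⟩
      + toℕ (rot (mean χ))                                  ∎)
      where
      open ≈-Reasoning
      identity : ∀ e w c → e ℤ.* w ≡ e ℤ.* (w ℤ.+ c) ℤ.- e ℤ.* c
      identity = solve-∀
      identity₂ : ∀ a → a ℤ.+ 1ℤ ℤ.- 1ℤ ≡ a
      identity₂ = solve-∀

  -- Labellings

  fibre : ∀ {n} → V n → Fin p → Subset n
  fibre X i = Vec.map (λ x → does (Maybeₚ.≡-dec _≟_ x (just i))) X

  ∈-fibre⁺ : ∀ {n} (X : V n) i a → lookup X a ≡ just i → a ∈ fibre X i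
  ∈-fibre⁺ X i a e = Vecₚ.lookup⇒[]= a (fibre X i)
    (trans (Vecₚ.lookup-map a _ X) (dec-true (Maybeₚ.≡-dec _≟_ (lookup X a) (just i)) e))

  ∈-fibre⁻ : ∀ {n} (X : V n) i a → a ∈ fibre X i → lookup X a ≡ just i
  ∈-fibre⁻ X i a a∈ = does⇒ (Maybeₚ.≡-dec _≟_ (lookup X a) (just i))
    (trans (sym (Vecₚ.lookup-map a _ X)) (Vecₚ.[]=⇒lookup a∈))

  fibre-mono : ∀ {n} (X Y : V n) i → X ⊑ Y → fibre X i ⊆ fibre Y i
  fibre-mono X Y i X⊑Y {a} a∈ = ∈-fibre⁺ Y i a (X⊑Y a i (∈-fibre⁻ X i a a∈))

  fibre-act : ∀ {n} (X : V n) i → fibre (act X) (rot i) ≡ fibre X i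
  fibre-act X i = Subsetₚ.⊆-antisym
    (λ {a} a∈ → let j , e , rj≡ri = lookup-act⁻ X a (∈-fibre⁻ (act X) (rot i) a a∈)
                in ∈-fibre⁺ X i a (trans e (cong just (rot-injective rj≡ri))))
    (λ {a} a∈ → ∈-fibre⁺ (act X) (rot i) a (lookup-act⁺ X a (∈-fibre⁻ X i a a∈)))

  -- Such a property singles out, for each X, the signs whose fibre has it. These sets of signs grow
  -- with X and are permuted by the action.
  record UpSet (n : ℕ) : Set₁ where
    field
      Holds  : Subset n → Set
      holds? : Decidable Holds
      upward : ∀ {σ τ} → σ ⊆ τ → Holds σ → Holds τ

    signs : V n → Fin p → Bool
    signs X i = does (holds? (fibre X i))

    signs⁺ : ∀ X i → Holds (fibre X i) → signs X i ≡ true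
    signs⁺ X i = dec-true (holds? (fibre X i))

    signs⁻ : ∀ X i → signs X i ≡ true → Holds (fibre X i)
    signs⁻ X i = does⇒ (holds? (fibre X i))

    signs-act : ∀ X i → signs (act X) (rot i) ≡ signs X i
    signs-act X i = cong (does ∘ holds?) (fibre-act X i)

    signs-mono : ∀ X Y → X ⊑ Y → ∀ i → 𝟙 (signs X i) ≤ 𝟙 (signs Y i)
    signs-mono X Y X⊑Y i = 𝟙-mono (signs⁺ Y i ∘ upward (fibre-mono X Y i X⊑Y) ∘ signs⁻ X i)

    signs-tight : ∀ X Y → X ⊑ Y → count (signs X) ≡ count (signs Y) → signs X ≗ signs Y
    signs-tight X Y X⊑Y e i = 𝟙-injective (sum-mono-tight (signs-mono X Y X⊑Y) e i)

  -- Where all signs occur there is no equivariant choice depending only on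
  -- the set of signs, so a second family, with at most one sign, is used.
  module _ {n : ℕ} (U U′ : UpSet n) where
    private
      module U  = UpSet U
      module U′ = UpSet U′

    module _ (single : ∀ X → count (U′.signs X) ≤ 1)
             (full : ∀ X → p ≤ count (U.signs X) → 0 < count (U′.signs X)) where
      private
        pick : ∀ {X} → Dec (count (U.signs X) < p) → Fin p
        pick {X} (yes _) = mean (U.signs X)
        pick {X} (no _)  = mean (U′.signs X)

        count-act : ∀ X → count (U.signs (act X)) ≡ count (U.signs X)
        count-act X = count-rot {U.signs X} {U.signs (act X)} (U.signs-act X)

        pick-act : ∀ X → 0 < count (U.signs X) → (d : Dec _) (d′ : Dec _) → pick {act X} d ≡ rot (pick {X} d′)
        pick-act X 0<c (yes h) (yes h′) = mean-rot {U.signs X} {U.signs (act X)} (U.signs-act X) 0<c h′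
        pick-act X 0<c (yes h) (no h′)  = ⊥-elim (h′ (subst (_< p) (count-act X) h))
        pick-act X 0<c (no h)  (yes h′) = ⊥-elim (h (subst (_< p) (sym (count-act X)) h′))
        pick-act X 0<c (no h)  (no h′)  =
          mean-rot {U′.signs X} {U′.signs (act X)} (U′.signs-act X) (full X (ℕₚ.≮⇒≥ h′)) (ℕₚ.≤-<-trans (single X) 1<p)

        pick-const : ∀ X Y → X ⊑ Y → count (U.signs X) ≡ count (U.signs Y) →
                     (d : Dec _) (d′ : Dec _) → pick {X} d ≡ pick {Y} d′
        pick-const X Y X⊑Y e (yes h) (yes h′) = mean-cong (U.signs-tight X Y X⊑Y e)
        pick-const X Y X⊑Y e (yes h) (no h′)  = ⊥-elim (h′ (subst (_< p) e h))
        pick-const X Y X⊑Y e (no h)  (yes h′) = ⊥-elim (h (subst (_< p) (sym e) h′))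
        -- All signs occur at both ends, so both sets from `U′` are singletons and, being nested,
        -- equal.
        pick-const X Y X⊑Y e (no h)  (no h′)  = mean-cong (U′.signs-tight X Y X⊑Y
          (trans (one X (full X (ℕₚ.≮⇒≥ h))) (sym (one Y (full Y (ℕₚ.≮⇒≥ h′))))))
          where
          one : ∀ X → 0 < count (U′.signs X) → count (U′.signs X) ≡ 1
          one X pos = ℕₚ.≤-antisym (single X) pos

      upSetLabelling : Labelling n
      upSetLabelling = record
        { level      = count ∘ U.signs
        ; sign       = λ X → pick {X} (count (U.signs X) <? p)
        ; level-mono = λ X Y X⊑Y → sum-mono (U.signs-mono X Y X⊑Y)
        ; level-act  = count-act
        ; sign-act   = λ X pos → pick-act X pos (count (U.signs (act X)) <? p) (count (U.signs X) <? p)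
        ; sign-const = λ X Y X⊑Y _ e → pick-const X Y X⊑Y e (count (U.signs X) <? p) (count (U.signs Y) <? p)
        }

  open Labelling

  emptyLabelling : ∀ {n} → Labelling n
  emptyLabelling = record
    { level      = λ _ → 0
    ; sign       = λ _ → zero
    ; level-mono = λ _ _ _ → z≤n
    ; level-act  = λ _ → refl
    ; sign-act   = λ _ ()
    ; sign-const = λ _ _ _ ()
    }

  module _ {n : ℕ} (Λ M : Labelling n) where
    private
      first : ℕ → Fin p → Fin p → Fin p
      first zero    s t = t
      first (suc _) s t = s

      first-act : ∀ X l → level Λ X ≡ l → 0 < l + level M X → first l (sign Λ (act X)) (sign M (act X)) ≡ rot (first l (sign Λ X) (sign M X))
      first-act X zero    e h = sign-act M X h
      first-act X (suc l) e h = sign-act Λ X (subst (0 <_) (sym e) (s≤s z≤n))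

      first-const : ∀ X Y → X ⊑ Y → ∀ l → level Λ X ≡ l → level Λ Y ≡ l → 0 < l + level M X → level M X ≡ level M Y →
                    first l (sign Λ X) (sign M X) ≡ first l (sign Λ Y) (sign M Y)
      first-const X Y X⊑Y zero    eX eY h e = sign-const M X Y X⊑Y h e
      first-const X Y X⊑Y (suc l) eX eY h e = sign-const Λ X Y X⊑Y (subst (0 <_) (sym eX) (s≤s z≤n)) (trans eX (sym eY))

      split : ∀ {a b c d} → a ≤ b → c ≤ d → a + c ≡ b + d → a ≡ b × c ≡ d
      split {a} {b} {c} {d} a≤b c≤d e = a≡b , ℕₚ.+-cancelˡ-≡ a c d (trans e (cong (_+ d) (sym a≡b)))
        where
        a≡b : a ≡ b
        a≡b = ℕₚ.≤-antisym a≤b (ℕₚ.+-cancelʳ-≤ c b a (ℕₚ.≤-trans (ℕₚ.+-monoʳ-≤ b c≤d) (ℕₚ.≤-reflexive (sym e))))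

    -- If the sum of two monotone levels is the same at `X` and `Y`, so is each summand, and one
    -- labelling supplies the sign at both.
    joinLabelling : Labelling n
    joinLabelling = record
      { level      = λ X → level Λ X + level M X
      ; sign       = λ X → first (level Λ X) (sign Λ X) (sign M X)
      ; level-mono = λ X Y X⊑Y → ℕₚ.+-mono-≤ (level-mono Λ X Y X⊑Y) (level-mono M X Y X⊑Y)
      ; level-act  = λ X → cong₂ _+_ (level-act Λ X) (level-act M X)
      ; sign-act   = λ X h → trans (cong (λ l → first l (sign Λ (act X)) (sign M (act X))) (level-act Λ X)) (first-act X _ refl h)
      ; sign-const = λ X Y X⊑Y h e → let eΛ , eM = split (level-mono Λ X Y X⊑Y) (level-mono M X Y X⊑Y) e
                                     in trans (first-const X Y X⊑Y _ refl (sym eΛ) h eM)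
                                              (cong (λ l → first l (sign Λ Y) (sign M Y)) eΛ)
      }

    module _ (α : ℕ) (continue : ∀ X → α < level Λ X → 0 < level M X) where
      private
        pick : {P A : Set} → Dec P → A → A → A
        pick (yes _) x y = x
        pick (no _)  x y = y

        d? : ∀ X → Dec (level Λ X ≤ α)
        d? X = level Λ X ≤? α

        lev : ∀ X → Dec (level Λ X ≤ α) → ℕ
        lev X d = pick d (level Λ X) (α + level M X)

        sgn : ∀ X → Dec (level Λ X ≤ α) → Fin p
        sgn X d = pick d (sign Λ X) (sign M X)

        lev-mono : ∀ X Y → X ⊑ Y → ∀ d d′ → lev X d ≤ lev Y d′
        lev-mono X Y X⊑Y (yes h) (yes h′) = level-mono Λ X Y X⊑Y
        lev-mono X Y X⊑Y (yes h) (no h′)  = ℕₚ.≤-trans h (ℕₚ.m≤m+n α _)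
        lev-mono X Y X⊑Y (no h)  (yes h′) = ⊥-elim (h (ℕₚ.≤-trans (level-mono Λ X Y X⊑Y) h′))
        lev-mono X Y X⊑Y (no h)  (no h′)  = ℕₚ.+-monoʳ-≤ α (level-mono M X Y X⊑Y)

        lev-act : ∀ X d d′ → lev (act X) d ≡ lev X d′
        lev-act X (yes h) (yes h′) = level-act Λ X
        lev-act X (yes h) (no h′)  = ⊥-elim (h′ (subst (_≤ α) (level-act Λ X) h))
        lev-act X (no h)  (yes h′) = ⊥-elim (h (subst (_≤ α) (sym (level-act Λ X)) h′))
        lev-act X (no h)  (no h′)  = cong (_+_ α) (level-act M X)

        sgn-act : ∀ X d d′ → 0 < lev X d′ → sgn (act X) d ≡ rot (sgn X d′)
        sgn-act X (yes h) (yes h′) pos = sign-act Λ X pos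
        sgn-act X (yes h) (no h′)  pos = ⊥-elim (h′ (subst (_≤ α) (level-act Λ X) h))
        sgn-act X (no h)  (yes h′) pos = ⊥-elim (h (subst (_≤ α) (sym (level-act Λ X)) h′))
        sgn-act X (no h)  (no h′)  pos = sign-act M X (continue X (ℕₚ.≰⇒> h′))

        sgn-const : ∀ X Y → X ⊑ Y → ∀ d d′ → 0 < lev X d → lev X d ≡ lev Y d′ → sgn X d ≡ sgn Y d′
        sgn-const X Y X⊑Y (yes h) (yes h′) pos e = sign-const Λ X Y X⊑Y pos e
        sgn-const X Y X⊑Y (yes h) (no h′)  pos e = ⊥-elim (ℕₚ.<⇒≱ (continue Y (ℕₚ.≰⇒> h′))
          (ℕₚ.+-cancelˡ-≤ α _ 0 (ℕₚ.≤-trans (ℕₚ.≤-reflexive (sym e)) (ℕₚ.≤-trans h (ℕₚ.≤-reflexive (sym (ℕₚ.+-identityʳ α)))))))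
        sgn-const X Y X⊑Y (no h)  (yes h′) pos e = ⊥-elim (h (ℕₚ.≤-trans (level-mono Λ X Y X⊑Y) h′))
        sgn-const X Y X⊑Y (no h)  (no h′)  pos e =
          sign-const M X Y X⊑Y (continue X (ℕₚ.≰⇒> h)) (ℕₚ.+-cancelˡ-≡ α _ _ e)

      -- `M` is stacked above the part of `Λ` up to level `α`. By `continue` the part from `M`
      -- starts no lower than `α + 1`, so equal levels lie in the same part.
      continueLabelling : Labelling n
      continueLabelling = record
        { level      = λ X → lev X (d? X)
        ; sign       = λ X → sgn X (d? X)
        ; level-mono = λ X Y X⊑Y → lev-mono X Y X⊑Y (d? X) (d? Y)
        ; level-act  = λ X → lev-act X (d? (act X)) (d? X)
        ; sign-act   = λ X → sgn-act X (d? (act X)) (d? X)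
        ; sign-const = λ X Y X⊑Y → sgn-const X Y X⊑Y (d? X) (d? Y)
        }

      continue-level-≤ : ∀ {m} → (∀ X → level M X ≤ m) → ∀ X → level continueLabelling X ≤ α + m
      continue-level-≤ {m} h X = go (d? X)
        where
        go : ∀ d → lev X d ≤ α + m
        go (yes h′) = ℕₚ.≤-trans h′ (ℕₚ.m≤m+n α m)
        go (no _)   = ℕₚ.+-monoʳ-≤ α (h X)

      continue-level-positive : ∀ X → 0 < level Λ X → 0 < level continueLabelling X
      continue-level-positive X h = go (d? X)
        where
        go : ∀ d → 0 < lev X d
        go (yes _)  = h
        go (no h′)  = ℕₚ.≤-trans (continue X (ℕₚ.≰⇒> h′)) (ℕₚ.m≤n+m _ α)

  sumLabelling : ∀ {n K} → (Fin K → Labelling n) → Labelling n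
  sumLabelling {K = zero}  Λ = emptyLabelling
  sumLabelling {K = suc K} Λ = joinLabelling (Λ zero) (sumLabelling (Λ ∘ suc))

  level-sum : ∀ {n K} (Λ : Fin K → Labelling n) X → level (sumLabelling Λ) X ≡ sum (λ j → level (Λ j) X)
  level-sum {K = zero}  Λ X = refl
  level-sum {K = suc K} Λ X = cong (_+_ (level (Λ zero) X)) (level-sum (Λ ∘ suc) X)

count≤1 : ∀ {n} (χ : Fin n → Bool) → (∀ i j → χ i ≡ true → χ j ≡ true → i ≡ j) → count χ ≤ 1
count≤1 χ unique with count χ ≤? 1
... | yes h = h
... | no h with enumerate χ 2 (ℕₚ.≰⇒> h)
...   | f , inj , mem with inj (unique (f zero) (f (suc zero)) (mem zero) (mem (suc zero)))
...     | ()

-- Admissible sets and monochromatic edges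

module _ {n : ℕ} (A : Subset n) (k L : ℕ) where

  -- The vertices of the hypergraphs treated by induction on r; the size
  -- k of the paper is suc k here, and L = k gives the sets not contained
  -- in A.
  Admissible : Subset n → Set
  Admissible σ = ∣ σ ∣ ≡ suc k × ∣ σ ∩ A ∣ ≤ L

  admissible? : Decidable Admissible
  admissible? σ = (∣ σ ∣ ℕ.≟ suc k) ×-dec (∣ σ ∩ A ∣ ≤? L)

  record MonochromaticEdge (r : ℕ) (c : Subset n → ℕ) : Set where
    field
      colour        : ℕ
      edge          : Fin r → Subset n
      admissible    : ∀ i → Admissible (edge i)
      monochromatic : ∀ i → c (edge i) ≡ colour
      disjoint      : ∀ i j → i ≢ j → Disjoint (edge i) (edge j)

-- `L` is kept apart from `k` because the product step replaces them by different numbers. Colours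
-- are naturals bounded by `m` on admissible sets only, so colourings transfer easily to subsets.
ForcesEdges : ℕ → Set
ForcesEdges r = ∀ {n} (A : Subset n) k L m (c : Subset n → ℕ) →
  ∣ A ∣ ≤ r * L → r * k + (r ∸ 1) * m < n →
  (∀ σ → Admissible A k L σ → c σ < m) → MonochromaticEdge A k L r c

-- The prime case

module PrimeCase (q : ℕ) (p-prime : Prime (suc q)) where

  open Cyclic q using (p)
  open Dold q
  open Labellings q p-prime
  open Labelling

  -- Dold's theorem only refutes the absence of an edge; exhaustive search over the finite set `V n`
  -- then produces one.
  anyV? : ∀ {n} {P : V n → Set} → Decidable P → Dec (∃ P)
  anyV? {zero} P? with P? []
  ... | yes h = yes ([] , h)
  ... | no h  = no λ { ([] , h′) → h h′ }
  anyV? {suc n} P? with anyV? (P? ∘ (nothing ∷_)) | any? (λ i → anyV? (P? ∘ (just i ∷_)))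
  ... | yes (X , h) | _               = yes (nothing ∷ X , h)
  ... | no _        | yes (i , X , h) = yes (just i ∷ X , h)
  ... | no h        | no h′           = no λ { (nothing ∷ X , e) → h (X , e) ; (just i ∷ X , e) → h′ (i , X , e) }

  module _ {n : ℕ} (A : Subset n) (k L m : ℕ) (c : Subset n → ℕ) where

    coloured : Fin m → UpSet n
    coloured j = record
      { Holds  = λ τ → ∃ λ σ → σ ⊆ τ × Admissible A k L σ × c σ ≡ toℕ j
      ; holds? = λ τ → anySubset? (λ σ → (σ ⊆? τ) ×-dec admissible? A k L σ ×-dec (c σ ℕ.≟ toℕ j))
      ; upward = λ { τ⊆τ′ (σ , σ⊆τ , h) → σ , (λ {x} → ⊆-trans σ⊆τ τ⊆τ′ {x}) , h }
      }

    -- Second family for the colours: it can be empty, since without a monochromatic edge no colour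
    -- occurs in the fibres of all p signs.
    never : UpSet n
    never = record { Holds = λ _ → ⊥ ; holds? = λ _ → no id ; upward = λ _ → id }

    module Never = UpSet never

    never-single : ∀ X → count (Never.signs X) ≤ 1
    never-single X = count≤1 (Never.signs X) (λ _ _ ())

    -- Fibres of distinct signs are disjoint, so admissible sets of one colour in all of them form a
    -- hyperedge.
    Found : V n → Set
    Found X = ∃ λ j → ∀ i → UpSet.Holds (coloured j) (fibre X i)

    found? : Decidable Found
    found? X = any? (λ j → all? (λ i → UpSet.holds? (coloured j) (fibre X i)))

    found⇒edge : ∀ X → Found X → MonochromaticEdge A k L p c
    found⇒edge X (j , h) = record
      { colour        = toℕ j
      ; edge          = proj₁ ∘ h
      ; admissible    = λ i → proj₁ (proj₂ (proj₂ (h i)))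
      ; monochromatic = λ i → proj₂ (proj₂ (proj₂ (h i)))
      ; disjoint      = λ i i′ i≢i′ a a∈ a∈′ → i≢i′ (Maybeₚ.just-injective
          (trans (sym (∈-fibre⁻ X i a (proj₁ (proj₂ (h i)) a∈))) (∈-fibre⁻ X i′ a (proj₁ (proj₂ (h i′)) a∈′))))
      }

    module _ (∣A∣≤pL : ∣ A ∣ ≤ p * L) (small : p * k + q * m < n)
             (c<m : ∀ σ → Admissible A k L σ → c σ < m) (none : ¬ ∃ Found) where

      notFull : ∀ j X → count (UpSet.signs (coloured j) X) ≤ q
      notFull j X with count (UpSet.signs (coloured j) X) <? p
      ... | yes (s≤s h) = h
      ... | no h = ⊥-elim (none (X , j , λ i →
        UpSet.signs⁻ (coloured j) X i (full⇒all (UpSet.signs (coloured j) X) (ℕₚ.≮⇒≥ h) i)))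

      colourFamily : Fin m → Labelling n
      colourFamily j = upSetLabelling (coloured j) never never-single (λ X h → ⊥-elim (ℕₚ.<⇒≱ h (notFull j X)))

      colourLabelling : Labelling n
      colourLabelling = sumLabelling colourFamily

      -- [n] is cut into blocks of p slots, listing the elements of A first.
      slotOf : Bool → Fin n → ℕ
      slotOf true  a = rank (lookup A) a
      slotOf false a = L * p + toℕ a

      slot : Fin n → ℕ
      slot a = slotOf (lookup A a) a

      rank<Lp : ∀ a → lookup A a ≡ true → rank (lookup A) a < L * p
      rank<Lp a e = ℕₚ.<-≤-trans (rank<count (lookup A) a e)
        (ℕₚ.≤-trans (ℕₚ.≤-reflexive (sym (∣∣≡count A))) (ℕₚ.≤-trans ∣A∣≤pL (ℕₚ.≤-reflexive (ℕₚ.*-comm p L))))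

      slot-injective : ∀ a b → slot a ≡ slot b → a ≡ b
      slot-injective a b = go (lookup A a) (lookup A b) refl refl
        where
        go : ∀ x y → lookup A a ≡ x → lookup A b ≡ y → slotOf x a ≡ slotOf y b → a ≡ b
        go true  true  ea eb e = rank-injective (lookup A) a b ea eb e
        go true  false ea eb e = ⊥-elim (ℕₚ.<⇒≱ (rank<Lp a ea) (ℕₚ.≤-trans (ℕₚ.m≤m+n _ _) (ℕₚ.≤-reflexive (sym e))))
        go false true  ea eb e = ⊥-elim (ℕₚ.<⇒≱ (rank<Lp b eb) (ℕₚ.≤-trans (ℕₚ.m≤m+n _ _) (ℕₚ.≤-reflexive e)))
        go false false ea eb e = toℕ-injective (ℕₚ.+-cancelˡ-≡ (L * p) _ _ e)

      -- A crude bound on the number of blocks: every slot is below `L * p + n`, hence below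
      -- `K * p`.
      K : ℕ
      K = L + n

      block : Fin n → ℕ
      block a = slot a / p

      block<L : ∀ a → a ∈ A → block a < L
      block<L a a∈A = m<n*o⇒m/o<n (subst (λ x → slotOf x a < L * p) (sym e) (rank<Lp a e))
        where
        e : lookup A a ≡ true
        e = Vecₚ.[]=⇒lookup a∈A

      block<K : ∀ a → block a < K
      block<K a = m<n*o⇒m/o<n (go (lookup A a) refl)
        where
        go : ∀ x → lookup A a ≡ x → slotOf x a < K * p
        go true  e = ℕₚ.<-≤-trans (rank<Lp a e) (ℕₚ.*-monoˡ-≤ p (ℕₚ.m≤m+n L n))
        go false e = ℕₚ.<-≤-trans (ℕₚ.+-monoʳ-< (L * p) (ℕₚ.<-≤-trans (toℕ<n a) (ℕₚ.m≤m*n n p)))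
                                  (ℕₚ.≤-reflexive (sym (ℕₚ.*-distribʳ-+ p L n)))

      -- `inBlock j` yields the signs counted on block `j`. `firstSlot j` looks at the single slot
      -- `j * p`, which carries at most one sign, and decides when all p signs occur in the block.
      inBlock firstSlot : Fin K → UpSet n
      inBlock j = record
        { Holds  = λ τ → ∃ λ a → a ∈ τ × block a ≡ toℕ j
        ; holds? = λ τ → any? (λ a → (a ∈? τ) ×-dec (block a ℕ.≟ toℕ j))
        ; upward = λ { τ⊆τ′ (a , a∈ , e) → a , τ⊆τ′ a∈ , e }
        }
      firstSlot j = record
        { Holds  = λ τ → ∃ λ a → a ∈ τ × slot a ≡ toℕ j * p
        ; holds? = λ τ → any? (λ a → (a ∈? τ) ×-dec (slot a ℕ.≟ toℕ j * p))
        ; upward = λ { τ⊆τ′ (a , a∈ , e) → a , τ⊆τ′ a∈ , e }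
        }

      single : ∀ j X → count (UpSet.signs (firstSlot j) X) ≤ 1
      single j X = count≤1 _ unique
        where
        open UpSet (firstSlot j)
        unique : ∀ i i′ → signs X i ≡ true → signs X i′ ≡ true → i ≡ i′
        unique i i′ h h′ with signs⁻ X i h | signs⁻ X i′ h′
        ... | a , a∈ , e | b , b∈ , e′ with slot-injective a b (trans e (sym e′))
        ... | refl = Maybeₚ.just-injective (trans (sym (∈-fibre⁻ X i a a∈)) (∈-fibre⁻ X i′ a b∈))

      -- If all p signs occur in a block of p slots, all slots are used.
      full : ∀ j X → p ≤ count (UpSet.signs (inBlock j) X) → 0 < count (UpSet.signs (firstSlot j) X)
      full j X h = go (any? (λ i → offset i ℕ.≟ 0))
        where
        witness : ∀ i → ∃ λ a → a ∈ fibre X i × block a ≡ toℕ j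
        witness i = UpSet.signs⁻ (inBlock j) X i (full⇒all (UpSet.signs (inBlock j) X) h i)

        at : Fin p → Fin n
        at = proj₁ ∘ witness

        offset : Fin p → ℕ
        offset i = slot (at i) % p

        slot-at : ∀ i → slot (at i) ≡ offset i + toℕ j * p
        slot-at i = trans (m≡m%n+[m/n]*n (slot (at i)) p) (cong (λ b → offset i + b * p) (proj₂ (proj₂ (witness i))))

        offset-injective : ∀ i i′ → offset i ≡ offset i′ → i ≡ i′
        offset-injective i i′ e = Maybeₚ.just-injective (begin
          just i             ≡⟨ ∈-fibre⁻ X i (at i) (proj₁ (proj₂ (witness i))) ⟨
          lookup X (at i)    ≡⟨ cong (lookup X) (slot-injective (at i) (at i′)
                                  (trans (slot-at i) (trans (cong (_+ toℕ j * p) e) (sym (slot-at i′))))) ⟩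
          lookup X (at i′)   ≡⟨ ∈-fibre⁻ X i′ (at i′) (proj₁ (proj₂ (witness i′))) ⟩
          just i′            ∎)
          where open ≡-Reasoning

        go : Dec (∃ λ i → offset i ≡ 0) → 0 < count (UpSet.signs (firstSlot j) X)
        go (yes (i , e)) = count-positive (UpSet.signs (firstSlot j) X) i
          (UpSet.signs⁺ (firstSlot j) X i
            (at i , proj₁ (proj₂ (witness i)) , trans (slot-at i) (cong (_+ toℕ j * p) e)))
        -- Otherwise p distinct offsets lie between 1 and `q`; subtracting 1 would embed `Fin p` in
        -- `Fin q`.
        go (no none₀) = ⊥-elim (ℕₚ.1+n≰n (injective⇒≤ {f = λ i → fromℕ< (below i)}
          (λ {i} {i′} e → offset-injective i i′ (ℕₚ.pred-injective {{nonZero i}} {{nonZero i′}} (fromℕ<-injective _ _ (below i) (below i′) e)))))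
          where
          nonZero : ∀ i → ℕ.NonZero (offset i)
          nonZero i = ℕ.≢-nonZero (λ e → none₀ (i , e))
          below : ∀ i → ℕ.pred (offset i) < q
          below i = ℕₚ.≤-pred (ℕₚ.≤-trans (ℕₚ.≤-reflexive (cong suc (ℕₚ.suc-pred (offset i) {{nonZero i}}))) (m%n<n (slot (at i)) p))

      blockFamily : Fin K → Labelling n
      blockFamily j = upSetLabelling (inBlock j) (firstSlot j) (single j) (full j)

      blockLabelling : Labelling n
      blockLabelling = sumLabelling blockFamily

      blockSigns : V n → Fin K → Fin p → Bool
      blockSigns X j i = UpSet.signs (inBlock j) X i

      block-positive : ∀ X → NonZero X → 0 < level blockLabelling X
      block-positive X (a , i , e) = subst (0 <_) (sym (level-sum blockFamily X))
        (sum-positive (λ j → level (blockFamily j) X) j (count-positive (blockSigns X j) i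
          (UpSet.signs⁺ (inBlock j) X i (a , ∈-fibre⁺ X i a e , sym (toℕ-fromℕ< (block<K a))))))
        where
        j : Fin K
        j = fromℕ< (block<K a)

      -- A sign occurring in more than k blocks carries a transversal of
      -- suc k blocks, and L blocks cover A.
      transversal : ∀ X i → k < count (λ j → blockSigns X j i) → ∃ λ σ → σ ⊆ fibre X i × Admissible A k L σ
      transversal X i h with enumerate (λ j → blockSigns X j i) (suc k) h
      ... | f , f-injective , f-true = σ , (λ {a} → σ⊆ {a}) , ∣σ∣≡ , ∣σ∩A∣≤L
        where
        witness : ∀ t → ∃ λ a → a ∈ fibre X i × block a ≡ toℕ (f t)
        witness t = UpSet.signs⁻ (inBlock (f t)) X i (f-true t)

        at : Fin (suc k) → Fin n
        at = proj₁ ∘ witness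

        at-block : ∀ s t → block (at s) ≡ block (at t) → s ≡ t
        at-block s t e = f-injective (toℕ-injective
          (trans (sym (proj₂ (proj₂ (witness s)))) (trans e (proj₂ (proj₂ (witness t))))))

        chosen? : ∀ a → Dec (∃ λ t → at t ≡ a)
        chosen? a = any? (λ t → at t ≟ a)

        chosen : ∃ λ σ → ∣ σ ∣ ≡ suc k × (∀ a → a ∈ σ → does (chosen? a) ≡ true)
        chosen = subsetOfSize (does ∘ chosen?) (suc k) (injective⇒≤count at (λ {s} {t} e → at-block s t (cong block e))
          (does ∘ chosen?) (λ t → dec-true (chosen? (at t)) (t , refl)))

        σ : Subset n
        σ = proj₁ chosen

        ∣σ∣≡ : ∣ σ ∣ ≡ suc k
        ∣σ∣≡ = proj₁ (proj₂ chosen)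

        σ-chosen : ∀ a → a ∈ σ → ∃ λ t → at t ≡ a
        σ-chosen a a∈ = does⇒ (chosen? a) (proj₂ (proj₂ chosen) a a∈)

        σ⊆ : σ ⊆ fibre X i
        σ⊆ {a} a∈ with σ-chosen a a∈
        ... | t , refl = proj₁ (proj₂ (witness t))

        block-injective : ∀ a b → a ∈ σ → b ∈ σ → block a ≡ block b → a ≡ b
        block-injective a b a∈ b∈ e with σ-chosen a a∈ | σ-chosen b b∈
        ... | s , refl | t , refl = cong at (at-block s t e)

        ∣σ∩A∣≤L : ∣ σ ∩ A ∣ ≤ L
        ∣σ∩A∣≤L = ∣∣≤-of-injection (σ ∩ A) block
          (λ a a∈ → block<L a (proj₂ (x∈p∩q⁻ σ A a∈)))
          (λ a b a∈ b∈ → block-injective a b (proj₁ (x∈p∩q⁻ σ A a∈)) (proj₁ (x∈p∩q⁻ σ A b∈)))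

      coloured-positive : ∀ X i → (∃ λ σ → σ ⊆ fibre X i × Admissible A k L σ) → 0 < level colourLabelling X
      coloured-positive X i (σ , σ⊆ , adm) = subst (0 <_) (sym (level-sum colourFamily X))
        (sum-positive (λ j → level (colourFamily j) X) j
          (count-positive (UpSet.signs (coloured j) X) i
            (UpSet.signs⁺ (coloured j) X i (σ , (λ {a} → σ⊆ {a}) , adm , sym (toℕ-fromℕ< (c<m σ adm))))))
        where
        j : Fin m
        j = fromℕ< (c<m σ adm)

      -- Double counting of pairs of a block and a sign occurring in it: more than p k pairs give
      -- some sign more than k blocks.
      continue : ∀ X → p * k < level blockLabelling X → 0 < level colourLabelling X
      continue X h = coloured-positive X (proj₁ popular) (transversal X (proj₁ popular) (proj₂ popular))
        where
        popular : ∃ λ i → k < count (λ j → blockSigns X j i)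
        popular = sum-pigeonhole (λ i → count (λ j → blockSigns X j i)) k
          (subst (p * k <_) (trans (level-sum blockFamily X) (∑-comm (λ j i → 𝟙 (blockSigns X j i)))) h)

      impossible : ⊥
      impossible = dold (continueLabelling blockLabelling colourLabelling (p * k) continue) 1<p
        (λ X nz → continue-level-positive blockLabelling colourLabelling (p * k) continue X (block-positive X nz))
        -- Each of the `m` colours misses a sign, so it adds at most `q` to the level.
        (λ X → ℕₚ.≤-<-trans (continue-level-≤ blockLabelling colourLabelling (p * k) continue colour-≤ X) small)
        where
        colour-≤ : ∀ X → level colourLabelling X ≤ q * m
        colour-≤ X = ℕₚ.≤-trans (ℕₚ.≤-reflexive (level-sum colourFamily X))
          (ℕₚ.≤-trans (sum-≤ (λ j → notFull j X)) (ℕₚ.≤-reflexive (ℕₚ.*-comm m q)))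

  prime-forcesEdges : ForcesEdges p
  prime-forcesEdges A k L m c ∣A∣≤pL small c<m with anyV? (found? A k L m c)
  ... | yes (X , found) = found⇒edge A k L m c X found
  ... | no none         = ⊥-elim (impossible A k L m c ∣A∣≤pL small c<m none)

-- Composite numbers

-- `expand S` and `restrict S` identify subsets of `S` with subsets of [|S|], so that `ForcesEdges`
-- can be applied inside `S`.
expand : ∀ {n} (S : Subset n) → Subset ∣ S ∣ → Subset n
expand []            τ       = []
expand (inside ∷ S)  (x ∷ τ) = x ∷ expand S τ
expand (outside ∷ S) τ       = outside ∷ expand S τ

restrict : ∀ {n} (S : Subset n) → Subset n → Subset ∣ S ∣
restrict []            A       = []
restrict (inside ∷ S)  (x ∷ A) = x ∷ restrict S A
restrict (outside ∷ S) (x ∷ A) = restrict S A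

∣expand∣ : ∀ {n} (S : Subset n) τ → ∣ expand S τ ∣ ≡ ∣ τ ∣
∣expand∣ []            []            = refl
∣expand∣ (inside ∷ S)  (inside ∷ τ)  = cong suc (∣expand∣ S τ)
∣expand∣ (inside ∷ S)  (outside ∷ τ) = ∣expand∣ S τ
∣expand∣ (outside ∷ S) τ             = ∣expand∣ S τ

∣expand∩∣ : ∀ {n} (S : Subset n) τ A → ∣ expand S τ ∩ A ∣ ≡ ∣ τ ∩ restrict S A ∣
∣expand∩∣ []            []            []            = refl
∣expand∩∣ (inside ∷ S)  (inside ∷ τ)  (inside ∷ A)  = cong suc (∣expand∩∣ S τ A)
∣expand∩∣ (inside ∷ S)  (inside ∷ τ)  (outside ∷ A) = ∣expand∩∣ S τ A
∣expand∩∣ (inside ∷ S)  (outside ∷ τ) (x ∷ A)       = ∣expand∩∣ S τ A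
∣expand∩∣ (outside ∷ S) τ             (x ∷ A)       = ∣expand∩∣ S τ A

∣restrict∣ : ∀ {n} (S A : Subset n) → ∣ restrict S A ∣ ≡ ∣ S ∩ A ∣
∣restrict∣ []            []            = refl
∣restrict∣ (inside ∷ S)  (inside ∷ A)  = cong suc (∣restrict∣ S A)
∣restrict∣ (inside ∷ S)  (outside ∷ A) = ∣restrict∣ S A
∣restrict∣ (outside ∷ S) (x ∷ A)       = ∣restrict∣ S A

expand-⊆ : ∀ {n} (S : Subset n) τ → expand S τ ⊆ S
expand-⊆ (inside ∷ S)  (inside ∷ τ) here       = here
expand-⊆ (inside ∷ S)  (x ∷ τ)      (there a∈) = there (expand-⊆ S τ a∈)
expand-⊆ (outside ∷ S) τ            (there a∈) = there (expand-⊆ S τ a∈)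

expand-disjoint : ∀ {n} (S : Subset n) τ τ′ → Disjoint τ τ′ → Disjoint (expand S τ) (expand S τ′)
expand-disjoint (inside ∷ S)  (inside ∷ τ) (inside ∷ τ′) d zero    here       here        = d zero here here
expand-disjoint (inside ∷ S)  (x ∷ τ)      (y ∷ τ′)      d (suc a) (there a∈) (there a∈′) =
  expand-disjoint S τ τ′ (λ b b∈ b∈′ → d (suc b) (there b∈) (there b∈′)) a a∈ a∈′
expand-disjoint (outside ∷ S) τ            τ′            d (suc a) (there a∈) (there a∈′) =
  expand-disjoint S τ τ′ d a a∈ a∈′

open MonochromaticEdge

module Product {x y : ℕ} (forces₁ : ForcesEdges (suc x)) (forces₂ : ForcesEdges (suc y)) where

  module _ {n : ℕ} (A : Subset n) (k L m : ℕ) (c : Subset n → ℕ)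
           (c<m : ∀ σ → Admissible A k L σ → c σ < m) where

    -- Chosen so that a set of size `suc k₁` with at most `L₁` elements in `A` just meets the
    -- hypotheses of `forces₁`.
    k₁ L₁ : ℕ
    k₁ = suc x * k + x * m
    L₁ = suc x * L

    EdgeIn : Subset n → Set
    EdgeIn S = Σ (MonochromaticEdge A k L (suc x) c) λ E → ∀ i → edge E i ⊆ S

    expand-admissible : ∀ S τ → Admissible (restrict S A) k L τ → Admissible A k L (expand S τ)
    expand-admissible S τ (size , meet) = trans (∣expand∣ S τ) size , subst (_≤ L) (sym (∣expand∩∣ S τ A)) meet

    edgeIn : ∀ S → Admissible A k₁ L₁ S → EdgeIn S
    edgeIn S (size , meet) = record
      { colour        = colour E
      ; edge          = expand S ∘ edge E
      ; admissible    = λ i → expand-admissible S (edge E i) (admissible E i)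
      ; monochromatic = monochromatic E
      ; disjoint      = λ i j i≢j → expand-disjoint S (edge E i) (edge E j) (disjoint E i j i≢j)
      } , λ i → expand-⊆ S (edge E i)
      where
      E : MonochromaticEdge (restrict S A) k L (suc x) (c ∘ expand S)
      E = forces₁ (restrict S A) k L m (c ∘ expand S) (subst (_≤ L₁) (sym (∣restrict∣ S A)) meet)
        (ℕₚ.≤-reflexive (sym size)) (λ τ adm → c<m (expand S τ) (expand-admissible S τ adm))

    colourOf : ∀ S → Dec (Admissible A k₁ L₁ S) → ℕ
    colourOf S (yes adm) = colour (proj₁ (edgeIn S adm))
    colourOf S (no _)    = 0

    c₁ : Subset n → ℕ
    c₁ S = colourOf S (admissible? A k₁ L₁ S)

    -- The edge is read off from the decision that defines `c₁`, so no two proofs of admissibility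
    -- need comparing.
    edgeOfColour : ∀ S → Admissible A k₁ L₁ S → Σ (EdgeIn S) λ E → colour (proj₁ E) ≡ c₁ S
    edgeOfColour S adm = go (admissible? A k₁ L₁ S)
      where
      go : ∀ d → Σ (EdgeIn S) λ E → colour (proj₁ E) ≡ colourOf S d
      go (yes adm′) = edgeIn S adm′ , refl
      go (no ¬adm)  = ⊥-elim (¬adm adm)

    c₁<m : ∀ S → Admissible A k₁ L₁ S → c₁ S < m
    c₁<m S adm with edgeOfColour S adm
    ... | (E , _) , e = subst (_< m) (trans (monochromatic E zero) e) (c<m (edge E zero) (admissible E zero))

    -- Two members are disjoint because their outer sets are or, within one outer set, because the
    -- inner edge is.
    combineEdges : MonochromaticEdge A k₁ L₁ (suc y) c₁ → MonochromaticEdge A k L (suc x * suc y) c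
    combineEdges F = record
      { colour        = colour F
      ; edge          = λ i → member (split i)
      ; admissible    = λ i → admissible (inner (proj₂ (split i))) (proj₁ (split i))
      ; monochromatic = λ i → trans (monochromatic (inner (proj₂ (split i))) (proj₁ (split i)))
          (trans (proj₂ (edgeOfColour (edge F (proj₂ (split i))) (admissible F (proj₂ (split i))))) (monochromatic F (proj₂ (split i))))
      ; disjoint      = λ i j i≢j → member-disjoint (split i) (split j)
          (λ e → i≢j (trans (sym (combine-remQuot {suc x} (suc y) i))
                            (trans (cong (λ z → combine (proj₁ z) (proj₂ z)) e) (combine-remQuot {suc x} (suc y) j))))
      }
      where
      split : Fin (suc x * suc y) → Fin (suc x) × Fin (suc y)
      split = remQuot {suc x} (suc y)

      inner : Fin (suc y) → MonochromaticEdge A k L (suc x) c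
      inner j = proj₁ (proj₁ (edgeOfColour (edge F j) (admissible F j)))

      member : Fin (suc x) × Fin (suc y) → Subset n
      member (i , j) = edge (inner j) i

      member-⊆ : ∀ i j → member (i , j) ⊆ edge F j
      member-⊆ i j = proj₂ (proj₁ (edgeOfColour (edge F j) (admissible F j))) i

      member-disjoint : ∀ s t → s ≢ t → Disjoint (member s) (member t)
      member-disjoint (i , j) (i′ , j′) s≢t with j ≟ j′
      ... | yes refl = disjoint (inner j) i i′ (λ { refl → s≢t refl })
      ... | no j≢j′  = λ a a∈ a∈′ → disjoint F j j′ j≢j′ a (member-⊆ i j a∈) (member-⊆ i′ j′ a∈′)

  product-forcesEdges : ForcesEdges (suc x * suc y)
  product-forcesEdges {n} A k L m c ∣A∣≤ small c<m = combineEdges A k L m c c<m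
    (forces₂ A (k₁ A k L m c c<m) (L₁ A k L m c c<m) m (c₁ A k L m c c<m)
      (subst (∣ A ∣ ≤_) (lemma₁ x y L) ∣A∣≤) (subst (_< n) (lemma₂ x y k m) small) (c₁<m A k L m c c<m))
    where
    lemma₁ : ∀ x y l → suc x * suc y * l ≡ suc y * (suc x * l)
    lemma₁ = ℕ-RingSolver.solve-∀
    -- `y + x * suc y` is what `suc x * suc y ∸ 1` reduces to.
    lemma₂ : ∀ x y k m → suc x * suc y * k + (y + x * suc y) * m ≡ suc y * (suc x * k + x * m) + y * m
    lemma₂ = ℕ-RingSolver.solve-∀

forcesEdges : ∀ r → 2 ≤ r → ForcesEdges r
forcesEdges = <-rec (λ r → 2 ≤ r → ForcesEdges r) step
  where
  factor : ∀ {r} d e → r ≡ e * d → 2 ≤ d → 2 ≤ e → (∀ {s} → s < r → 2 ≤ s → ForcesEdges s) → ForcesEdges r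
  factor (suc d) (suc e) refl 2≤d 2≤e rec = product-forcesEdges
    where
    open Product {e} {d} (rec (ℕₚ.m<m*n (suc e) (suc d) 2≤d) 2≤e)
      (rec (ℕₚ.<-≤-trans (ℕₚ.m<m*n (suc d) (suc e) 2≤e) (ℕₚ.≤-reflexive (ℕₚ.*-comm (suc d) (suc e)))) 2≤d)

  step : ∀ r → (∀ {s} → s < r → 2 ≤ s → ForcesEdges s) → 2 ≤ r → ForcesEdges r
  step (suc (suc r)) rec (s≤s (s≤s z≤n)) with prime? (suc (suc r))
  ... | yes r-prime = PrimeCase.prime-forcesEdges (suc r) r-prime
  ... | no ¬prime with ¬prime⇒composite ¬prime
  ... | composite {d} d<r (divides e eq) = factor d e eq 2≤d (2≤e e eq) rec
    where
    2≤d : 2 ≤ d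
    2≤d = ℕ.nonTrivial⇒n>1 d
    2≤e : ∀ e → suc (suc r) ≡ e * d → 2 ≤ e
    2≤e zero          ()
    2≤e (suc zero)    eq = ⊥-elim (ℕₚ.<⇒≢ d<r (sym (trans eq (ℕₚ.+-identityʳ d))))
    2≤e (suc (suc e)) eq = s≤s (s≤s z≤n)

-- The bound b(r) ≤ r

spfOff-≤ : ∀ fuel e r → 2 ≤ r → 2 + spfOff fuel e r ≤ r
-- When the search runs out, the divisor taken is `r` itself.
spfOff-≤ zero       e r 2≤r = ℕₚ.≤-reflexive (ℕₚ.m+[n∸m]≡n 2≤r)
spfOff-≤ (suc fuel) e r 2≤r with suc (suc e) ∣? r
... | yes d∣r = ∣⇒≤ {{ℕ.>-nonZero (ℕₚ.<-trans (s≤s z≤n) 2≤r)}} d∣r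
... | no _    = spfOff-≤ fuel (suc e) r 2≤r

primeWeight-≤ : ∀ e → primeWeight e ≤ 2 + e
primeWeight-≤ zero    = ℕₚ.≤-refl
primeWeight-≤ (suc e) = ℕₚ.n≤1+n _

bAux-≤ : ∀ fuel r → 1 ≤ r → bAux fuel r ≤ r
bAux-≤ zero       r 1≤r = 1≤r
bAux-≤ (suc fuel) r 1≤r with r ≤? 1
... | yes _  = 1≤r
... | no r≰1 = begin
  primeWeight e * bAux fuel (r / (2 + e)) ≤⟨ ℕₚ.*-mono-≤ (primeWeight-≤ e) (bAux-≤ fuel (r / (2 + e)) (m≥n⇒m/n>0 2+e≤r)) ⟩
  (2 + e) * (r / (2 + e))                 ≡⟨ ℕₚ.*-comm (2 + e) (r / (2 + e)) ⟩
  r / (2 + e) * (2 + e)                   ≤⟨ m/n*n≤m r (2 + e) ⟩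
  r                                       ∎
  where
  open ℕₚ.≤-Reasoning
  e : ℕ
  e = spfOff r 0 r
  2+e≤r : 2 + e ≤ r
  2+e≤r = spfOff-≤ r 0 r (ℕₚ.≰⇒> r≰1)

b-≤ : ∀ r → 1 ≤ r → b r ≤ r
b-≤ r = bAux-≤ r r

-- From admissible sets to vertices of the hypergraph

module _ {n : ℕ} (A : Subset n) (k : ℕ) where

  admissible⇒⊈ : ∀ σ → Admissible A k k σ → ¬ (σ ⊆ A)
  admissible⇒⊈ σ (size , meet) σ⊆A = ℕₚ.1+n≰n (begin
    suc k     ≡⟨ size ⟨
    ∣ σ ∣     ≤⟨ p⊆q⇒∣p∣≤∣q∣ (λ a∈ → x∈p∩q⁺ (a∈ , σ⊆A a∈)) ⟩
    ∣ σ ∩ A ∣ ≤⟨ meet ⟩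
    k         ∎)
    where open ℕₚ.≤-Reasoning

  -- With `L = k`, admissible sets have more elements than they share with `A`, so they are vertices
  -- and the colouring restricts to them.
  not-colourable : ∀ r m → 2 ≤ r → ∣ A ∣ ≤ r * k → r * k + (r ∸ 1) * m < n →
                   (c : Vertex n (suc k) A → Fin m) → ¬ IsColoring r n (suc k) A m c
  not-colourable r@(suc _) m 2≤r ∣A∣≤ small c proper =
    proper (proj₁ ∘ vertex) disjoint′ (c (proj₁ (vertex zero)) , λ i → toℕ-injective
      (trans (same i) (sym (same zero))))
    where
    colourOf : ∀ σ → Dec (Admissible A k k σ) → ℕ
    colourOf σ (yes adm) = toℕ (c (σ , proj₁ adm , admissible⇒⊈ σ adm))
    colourOf σ (no _)    = 0

    c′ : Subset n → ℕ
    c′ σ = colourOf σ (admissible? A k k σ)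

    vertexOf : ∀ σ → Admissible A k k σ → Σ (Vertex n (suc k) A) λ v → proj₁ v ≡ σ × toℕ (c v) ≡ c′ σ
    vertexOf σ adm = go (admissible? A k k σ)
      where
      go : ∀ d → Σ (Vertex n (suc k) A) λ v → proj₁ v ≡ σ × toℕ (c v) ≡ colourOf σ d
      go (yes adm′) = (σ , proj₁ adm′ , admissible⇒⊈ σ adm′) , refl , refl
      go (no ¬adm)  = ⊥-elim (¬adm adm)

    c′<m : ∀ σ → Admissible A k k σ → c′ σ < m
    c′<m σ adm = subst (_< m) (proj₂ (proj₂ (vertexOf σ adm))) (toℕ<n (c (proj₁ (vertexOf σ adm))))

    E : MonochromaticEdge A k k r c′
    E = forcesEdges r 2≤r A k k m c′ ∣A∣≤ small c′<m

    vertex : ∀ i → Σ (Vertex n (suc k) A) λ v → proj₁ v ≡ edge E i × toℕ (c v) ≡ c′ (edge E i)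
    vertex i = vertexOf (edge E i) (admissible E i)

    same : ∀ i → toℕ (c (proj₁ (vertex i))) ≡ colour E
    same i = trans (proj₂ (proj₂ (vertex i))) (monochromatic E i)

    disjoint′ : IsHyperedge r (proj₁ ∘ vertex)
    disjoint′ i j i≢j a a∈ a∈′ = disjoint E i j i≢j a
      (subst (a ∈_) (proj₁ (proj₂ (vertex i))) a∈) (subst (a ∈_) (proj₁ (proj₂ (vertex j))) a∈′)

-- The standard colouring

least : ∀ {n} → Subset n → ℕ
least []            = 0
least (inside ∷ σ)  = 0
least (outside ∷ σ) = suc (least σ)

least-≤ : ∀ {n} (σ : Subset n) a → a ∈ σ → least σ ≤ toℕ a
least-≤ (inside ∷ σ)  a       a∈         = z≤n
least-≤ (outside ∷ σ) (suc a) (there a∈) = s≤s (least-≤ σ a a∈)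

least-∈ : ∀ {n k} (σ : Subset n) → ∣ σ ∣ ≡ suc k → ∃ λ a → a ∈ σ × toℕ a ≡ least σ
least-∈ (inside ∷ σ)  size = zero , here , refl
least-∈ (outside ∷ σ) size with least-∈ σ size
... | a , a∈ , e = suc a , there a∈ , cong suc e

module _ {n : ℕ} (A : Subset n) (k r N : ℕ) where

  private
    d : ℕ
    d = suc r

  -- Hyperedges have `suc d` members. The colour is the run of `d` consecutive integers containing
  -- the least element, and all late runs share the last colour `N`.
  standard : Vertex n (suc k) A → Fin (suc N)
  standard (σ , _) = fromℕ< (s≤s (ℕₚ.m⊓n≤n (least σ / d) N))

  standard-isColoring : n < N * d + suc d * suc k → IsColoring (suc d) n (suc k) A (suc N) standard
  standard-isColoring n< e disj (col , mono) with toℕ col <? N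
  -- Disjoint sets have distinct least elements, but here `suc d` of them would lie in one run of
  -- `d` integers.
  ... | yes col<N = ℕₚ.1+n≰n (injective⇒≤ {f = λ i → fromℕ< (m%n<n (μ i) d)} (λ {i} {j} h → injective i j (fromℕ<-injective _ _ _ _ h)))
    where
    μ : Fin (suc d) → ℕ
    μ i = least (proj₁ (e i))

    quotient : ∀ i → μ i / d ≡ toℕ col
    quotient i with ℕₚ.⊓-sel (μ i / d) N | trans (sym (toℕ-fromℕ< _)) (cong toℕ (mono i))
    ... | inj₁ h | h′ = trans (sym h) h′
    ... | inj₂ h | h′ = ⊥-elim (ℕₚ.<⇒≢ col<N (trans (sym h′) h))

    injective : ∀ i j → μ i % d ≡ μ j % d → i ≡ j
    injective i j h with i ≟ j
    ... | yes i≡j = i≡j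
    ... | no i≢j with least-∈ (proj₁ (e i)) (proj₁ (proj₂ (e i))) | least-∈ (proj₁ (e j)) (proj₁ (proj₂ (e j)))
    ... | a , a∈ , ea | a′ , a′∈ , ea′ = ⊥-elim (disj i j i≢j a a∈ (subst (_∈ proj₁ (e j)) (sym a≡a′) a′∈))
      where
      μi≡μj : μ i ≡ μ j
      μi≡μj = trans (m≡m%n+[m/n]*n (μ i) d) (trans (cong₂ (λ x y → x + y * d) h (trans (quotient i) (sym (quotient j))))
                    (sym (m≡m%n+[m/n]*n (μ j) d)))
      a≡a′ : a ≡ a′
      a≡a′ = toℕ-injective (trans ea (trans μi≡μj (sym ea′)))
  -- In the last colour all `suc d` disjoint sets consist of integers from `N * d` on, of which
  -- there are fewer than `suc d * suc k`.
  ... | no col≮N = ℕₚ.<⇒≱ n< (begin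
      N * d + suc d * suc k ≤⟨ ℕₚ.+-monoʳ-≤ (N * d) (injective⇒≤ {f = λ i → fromℕ< (below i)} injective) ⟩
      N * d + (n ∸ N * d)   ≡⟨ ℕₚ.m+[n∸m]≡n (ℕₚ.≤-trans (above zero) (ℕₚ.<⇒≤ (toℕ<n (at zero)))) ⟩
      n                     ∎)
    where
    open ℕₚ.≤-Reasoning
    split : Fin (suc d * suc k) → Fin (suc d) × Fin (suc k)
    split = remQuot {suc d} (suc k)

    members : ∀ i → Σ (Fin (suc k) → Fin n) λ f → Injective _≡_ _≡_ f × (∀ t → f t ∈ proj₁ (e i))
    members i = enumerate-∈ (proj₁ (e i)) (proj₁ (proj₂ (e i)))

    memberAt : Fin (suc d) × Fin (suc k) → Fin n
    memberAt (i , t) = proj₁ (members i) t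

    memberAt-injective : ∀ s t → memberAt s ≡ memberAt t → s ≡ t
    memberAt-injective (i , s) (j , t) h with i ≟ j
    ... | yes refl = cong (i ,_) (proj₁ (proj₂ (members i)) h)
    ... | no i≢j   = ⊥-elim (disj i j i≢j (memberAt (i , s)) (proj₂ (proj₂ (members i)) s)
                              (subst (_∈ proj₁ (e j)) (sym h) (proj₂ (proj₂ (members j)) t)))

    at : Fin (suc d * suc k) → Fin n
    at = memberAt ∘ split

    N≤quotient : ∀ i → N ≤ least (proj₁ (e i)) / d
    N≤quotient i = ℕₚ.≤-trans (ℕₚ.≮⇒≥ col≮N)
      (ℕₚ.≤-trans (ℕₚ.≤-reflexive (trans (cong toℕ (sym (mono i))) (toℕ-fromℕ< _))) (ℕₚ.m⊓n≤m _ N))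

    above : ∀ s → N * d ≤ toℕ (at s)
    above s = begin
      N * d                                          ≤⟨ ℕₚ.*-monoˡ-≤ d (N≤quotient i) ⟩
      least (proj₁ (e i)) / d * d                    ≤⟨ m/n*n≤m (least (proj₁ (e i))) d ⟩
      least (proj₁ (e i))                            ≤⟨ least-≤ (proj₁ (e i)) (at s) (proj₂ (proj₂ (members i)) (proj₂ (split s))) ⟩
      toℕ (at s)                                     ∎
      where
      i : Fin (suc d)
      i = proj₁ (split s)

    below : ∀ s → toℕ (at s) ∸ N * d < n ∸ N * d
    below s = ℕₚ.∸-monoˡ-< (toℕ<n (at s)) (above s)

    injective : ∀ {s t} → fromℕ< (below s) ≡ fromℕ< (below t) → s ≡ t
    injective {s} {t} h = trans (sym (combine-remQuot {suc d} (suc k) s)) (trans (cong (λ z → combine (proj₁ z) (proj₂ z)) (memberAt-injective (split s) (split t)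
      (toℕ-injective (ℕₚ.∸-cancelʳ-≡ (above s) (above t) (fromℕ<-injective _ _ _ _ h)))))
      (combine-remQuot {suc d} (suc k) t))

-- Ceiling division and the chromatic number

ceilDiv-≤ : ∀ a d m → m < ceilDiv a (suc d) → suc d * m < a
ceilDiv-≤ a d m h = ℕₚ.+-cancelʳ-≤ d _ a (begin
  suc (suc d * m) + d   ≡⟨ lemma d m ⟩
  suc m * suc d         ≤⟨ ℕₚ.*-monoˡ-≤ (suc d) h ⟩
  (a + d) / suc d * suc d ≤⟨ m/n*n≤m (a + d) (suc d) ⟩
  a + d                 ∎)
  where
  open ℕₚ.≤-Reasoning
  lemma : ∀ d m → suc (suc d * m) + d ≡ suc m * suc d
  lemma = ℕ-RingSolver.solve-∀

≤-ceilDiv : ∀ a d → a ≤ ceilDiv a (suc d) * suc d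
≤-ceilDiv a d = ℕₚ.+-cancelʳ-≤ d a _ (begin
  a + d ≡⟨ m≡m%n+[m/n]*n (a + d) (suc d) ⟩
  (a + d) % suc d + (a + d) / suc d * suc d ≤⟨ ℕₚ.+-monoˡ-≤ _ (ℕₚ.≤-pred (m%n<n (a + d) (suc d))) ⟩
  d + (a + d) / suc d * suc d ≡⟨ ℕₚ.+-comm d _ ⟩
  (a + d) / suc d * suc d + d ∎)
  where open ℕₚ.≤-Reasoning

chromaticNumber : ∀ r k n → suc (suc r) * k < n → (A : Subset n) → ∣ A ∣ ≤ suc (suc r) * k →
  ChromaticNumberIs (suc (suc r)) n (suc k) A (ceilDiv (n ∸ suc (suc r) * k) (suc r))
chromaticNumber r k n rk<n A ∣A∣≤ with ceilDiv (n ∸ suc (suc r) * k) (suc r) | ≤-ceilDiv (n ∸ suc (suc r) * k) r | ceilDiv-≤ (n ∸ suc (suc r) * k) r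
-- The numerator is positive, hence so is the ceiling, and `standard` has a last colour.
... | zero  | up | _  = ⊥-elim (ℕₚ.<⇒≱ (ℕₚ.m<n⇒0<n∸m rk<n) up)
... | suc N | up | lo = (standard A k r N , standard-isColoring A k r N bound) , minimal
  where
  bound : n < N * suc r + suc (suc r) * suc k
  bound = begin-strict
    n                                                   ≡⟨ ℕₚ.m+[n∸m]≡n (ℕₚ.<⇒≤ rk<n) ⟨
    suc (suc r) * k + (n ∸ suc (suc r) * k)             ≤⟨ ℕₚ.+-monoʳ-≤ (suc (suc r) * k) up ⟩
    suc (suc r) * k + suc N * suc r                     <⟨ ℕₚ.n<1+n _ ⟩
    suc (suc (suc r) * k + suc N * suc r)               ≡⟨ lemma r k N ⟩
    N * suc r + suc (suc r) * suc k                     ∎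
    where
    open ℕₚ.≤-Reasoning
    lemma : ∀ r k N → suc (suc (suc r) * k + suc N * suc r) ≡ N * suc r + suc (suc r) * suc k
    lemma = ℕ-RingSolver.solve-∀
  minimal : ∀ m (c : Vertex n (suc k) A → Fin m) → IsColoring (suc (suc r)) n (suc k) A m c → suc N ≤ m
  minimal m c proper with suc N ≤? m
  ... | yes h = h
  ... | no h  = ⊥-elim (not-colourable A k (suc (suc r)) m (s≤s (s≤s z≤n)) ∣A∣≤ small c proper)
    where
    small : suc (suc r) * k + suc r * m < n
    small = subst (suc (suc r) * k + suc r * m <_) (ℕₚ.m+[n∸m]≡n (ℕₚ.<⇒≤ rk<n))
      (ℕₚ.+-monoʳ-< (suc (suc r) * k) (lo m (ℕₚ.≰⇒> h)))

theorem4p2 : (r k n : ℕ) → 2 ≤ r → 1 ≤ k → 2 * r * k ≤ n →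
    (A : Subset n) → ∣ A ∣ ≤ b r * (k ∸ 1) →
    ChromaticNumberIs r n k A (ceilDiv (n ∸ max (r * (k ∸ 1)) ∣ A ∣) (r ∸ 1))
theorem4p2 (suc (suc r)) (suc k) n (s≤s (s≤s z≤n)) (s≤s z≤n) large A ∣A∣≤ =
  subst (λ M → ChromaticNumberIs (suc (suc r)) n (suc k) A (ceilDiv (n ∸ M) (suc r)))
    (sym (ℕₚ.m≥n⇒m⊔n≡m ∣A∣≤rk)) (chromaticNumber r k n rk<n A ∣A∣≤rk)
  where
  ∣A∣≤rk : ∣ A ∣ ≤ suc (suc r) * k
  ∣A∣≤rk = ℕₚ.≤-trans ∣A∣≤ (ℕₚ.*-monoˡ-≤ k (b-≤ (suc (suc r)) (s≤s z≤n)))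
  rk<n : suc (suc r) * k < n
  rk<n = ℕₚ.<-≤-trans (ℕₚ.*-monoʳ-< (suc (suc r)) (ℕₚ.n<1+n k))
    (ℕₚ.≤-trans (ℕₚ.*-monoˡ-≤ (suc k) (ℕₚ.m≤m+n (suc (suc r)) _)) large)
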